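{- Let $n\ge 2$ be an integer and let $\mathcal{F}_n(x)$ be a generalized Fibonacci polynomial of Fibonacci type determined by $d(x)$ and $g(x)$. For $j=1,2,\dots,n-1$ let $\gamma_j=2i\cos\frac{j\pi}{n}$, where $i=\sqrt{ -1}$. If $r\in\mathbb{C}$ satisfies $g(r)\ne0$ and $d(r)/\sqrt{g(r)}=\gamma_j$ for some $j\in\{1,2,\dots,n-1\}$, then $r$ is a root of $\mathcal{F}_n(x)$.
   Context: Given nonzero polynomials $d(x),g(x)\in\mathbb{Q}[x]$ with $\deg d>\deg g$, the generalized Fibonacci polynomials of Fibonacci type are $\mathcal{F}_0(x)=0$, $\mathcal{F}_1(x)=1$, $\mathcal{F}_n(x)=d(x)\mathcal{F}_{n-1}(x)+g(x)\mathcal{F}_{n-2}(x)$ for $n\ge 2$. $\sqrt{g(r)}$ denotes a complex square root of $g(r)$. -}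

module Defs where

open import Data.Integer as ℤ using (+_)
import Data.Integer.Properties as ℤP
open import Data.List using (List; []; _∷_; map)
open import Data.List.Relation.Unary.Any using (Any; any?)
open import Data.Nat as ℕ using (ℕ; zero; suc; _!; NonZero)
import Data.Nat.Properties as ℕP
open import Data.Product using (∃; ∃-syntax; _×_; _,_; proj₁; proj₂)
open import Data.Rational
  using (ℚ; mkℚ; 0ℚ; 1ℚ; ½; _+_; _-_; _*_; -_; ∣_∣; _/_; 1/_; _≤_; _<_; Positive; ↥_; ↧ₙ_; toℚᵘ)
import Data.Rational as ℚ
open import Data.Rational.Properties
open import Data.Rational.Solver
open import Data.Rational.Unnormalised using (mkℚᵘ; *≡*)
import Data.Rational.Unnormalised as ℚᵘ
import Data.Rational.Unnormalised.Properties as ℚᵘP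
open import Data.Sum using (inj₁; inj₂)
open import Relation.Binary.PropositionalEquality
open import Relation.Nullary using (¬_; yes; no; contradiction; ¬?)

open import Algebra.Definitions.RawSemiring +-*-rawSemiring using (_^_) public

open +-*-Solver using (solve; _:=_; _:+_; _:*_; :-_; _:-_; con)

ι : ℕ → ℚ
ι n = + n / 1

module Aux where
  ι≃ : ∀ n → toℚᵘ (ι n) ℚᵘ.≃ mkℚᵘ (+ n) 0
  ι≃ n = toℚᵘ-fromℚᵘ (mkℚᵘ (+ n) 0)

  ι-* : ∀ m n → ι (m ℕ.* n) ≡ ι m * ι n
  ι-* m n = toℚᵘ-injective (ℚᵘP.≃-trans (ι≃ (m ℕ.* n)) (ℚᵘP.≃-trans
    (*≡* (cong (ℤ._* + 1) (ℤP.pos-* m n)))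
    (ℚᵘP.≃-sym (ℚᵘP.≃-trans (toℚᵘ-homo-* (ι m) (ι n)) (ℚᵘP.*-cong (ι≃ m) (ι≃ n))))))

  ι-+ : ∀ m n → ι (m ℕ.+ n) ≡ ι m + ι n
  ι-+ m n = toℚᵘ-injective (ℚᵘP.≃-trans (ι≃ (m ℕ.+ n)) (ℚᵘP.≃-trans
    (*≡* (cong (ℤ._* + 1) (trans (ℤP.pos-+ m n)
       (sym (cong₂ ℤ._+_ (ℤP.*-identityʳ (+ m)) (ℤP.*-identityʳ (+ n)))))))
    (ℚᵘP.≃-sym (ℚᵘP.≃-trans (toℚᵘ-homo-+ (ι m) (ι n)) (ℚᵘP.+-cong (ι≃ m) (ι≃ n))))))

  ι-mono : ∀ {m n} → m ℕ.≤ n → ι m ≤ ι n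
  ι-mono {m} {n} m≤n = toℚᵘ-cancel-≤ (ℚᵘP.≤-respˡ-≃ (ℚᵘP.≃-sym (ι≃ m)) (ℚᵘP.≤-respʳ-≃ (ℚᵘP.≃-sym (ι≃ n))
    (ℚᵘ.*≤* (ℤP.*-monoʳ-≤-nonNeg (+ 1) (ℤ.+≤+ m≤n)))))

  0≤ι : ∀ n → 0ℚ ≤ ι n
  0≤ι n = ι-mono {0} {n} ℕ.z≤n

  0<1 : 0ℚ < 1ℚ
  0<1 = positive⁻¹ 1ℚ

  0<ι : ∀ n → .{{ℕ.NonZero n}} → 0ℚ < ι n
  0<ι n = <-≤-trans 0<1 (ι-mono (ℕ.>-nonZero⁻¹ n))

  1/ι : ∀ n → .{{_ : ℕ.NonZero n}} → (+ 1 / n) * ι n ≡ 1ℚ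
  1/ι (suc n) = toℚᵘ-injective (ℚᵘP.≃-trans (toℚᵘ-homo-* (+ 1 / suc n) (ι (suc n)))
    (ℚᵘP.≃-trans (ℚᵘP.*-cong (toℚᵘ-fromℚᵘ (mkℚᵘ (+ 1) n)) (ι≃ (suc n)))
     (*≡* (trans (ℤP.*-identityʳ _) (trans (ℤP.*-identityˡ (+ suc n)) (sym (trans (ℤP.*-identityˡ _)
        (cong +_ (ℕP.*-identityʳ (suc n))))))))))

  nn*nn : ∀ {p q} → 0ℚ ≤ p → 0ℚ ≤ q → 0ℚ ≤ p * q
  nn*nn {p} {q} a b = nonNegative⁻¹ _ {{nonNeg*nonNeg⇒nonNeg p {{ℚ.nonNegative a}} q {{ℚ.nonNegative b}}}}

  pos*pos : ∀ {p q} → 0ℚ < p → 0ℚ < q → 0ℚ < p * q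
  pos*pos {p} {q} a b = positive⁻¹ _ {{pos*pos⇒pos p {{ℚ.positive a}} q {{ℚ.positive b}}}}

  *-mono-nn : ∀ {p p′ q q′} → 0ℚ ≤ p → 0ℚ ≤ q′ → p ≤ p′ → q ≤ q′ → p * q ≤ p′ * q′
  *-mono-nn {p} {p′} {q} {q′} a b p≤ q≤ =
    ≤-trans (*-monoˡ-≤-nonNeg p {{ℚ.nonNegative a}} q≤) (*-monoʳ-≤-nonNeg q′ {{ℚ.nonNegative b}} p≤)

  *-monoˡ : ∀ {p q q′} → 0ℚ ≤ p → q ≤ q′ → p * q ≤ p * q′
  *-monoˡ {p} a = *-monoˡ-≤-nonNeg p {{ℚ.nonNegative a}}

  *-monoʳ : ∀ {p q q′} → 0ℚ ≤ p → q ≤ q′ → q * p ≤ q′ * p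
  *-monoʳ {p} a = *-monoʳ-≤-nonNeg p {{ℚ.nonNegative a}}

  |-|-comm : ∀ p q → ∣ p - q ∣ ≡ ∣ q - p ∣
  |-|-comm p q = trans (cong ∣_∣ (solve 2 (λ p q → p :- q := :- (q :- p)) refl p q)) (∣-p∣≡∣p∣ (q - p))

  |-|-trans : ∀ p q r → ∣ p - r ∣ ≤ ∣ p - q ∣ + ∣ q - r ∣
  |-|-trans p q r = subst (λ t → ∣ t ∣ ≤ ∣ p - q ∣ + ∣ q - r ∣)
    (solve 3 (λ p q r → (p :- q) :+ (q :- r) := p :- r) refl p q r) (∣p+q∣≤∣p∣+∣q∣ (p - q) (q - r))

  p≤∣p∣ : ∀ p → p ≤ ∣ p ∣
  p≤∣p∣ p with ≤-total 0ℚ p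
  ... | inj₁ 0≤p = ≤-reflexive (sym (0≤p⇒∣p∣≡p 0≤p))
  ... | inj₂ p≤0 = ≤-trans p≤0 (0≤∣p∣ p)

  ε*↧ε≥1 : ∀ ε → 0ℚ < ε → 1ℚ ≤ ι (↧ₙ ε) * ε
  ε*↧ε≥1 ε@(mkℚ (+ zero) d c) 0<ε with ℚ.positive 0<ε
  ... | ()
  ε*↧ε≥1 ε@(mkℚ (ℤ.-[1+ n ]) d c) 0<ε with ℚ.positive 0<ε
  ... | ()
  ε*↧ε≥1 ε@(mkℚ (+ suc n) d c) 0<ε = toℚᵘ-cancel-≤
    (ℚᵘP.≤-respʳ-≃ (ℚᵘP.≃-sym (ℚᵘP.≃-trans (toℚᵘ-homo-* (ι (suc d)) ε) (ℚᵘP.*-congʳ {toℚᵘ ε} (ι≃ (suc d)))))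
      (ℚᵘ.*≤* (subst₂ ℤ._≤_ refl refl (ℤ.+≤+ le))))
    where
    le : 1 ℕ.* suc (d ℕ.+ 0) ℕ.≤ suc (n ℕ.+ d ℕ.* suc n) ℕ.* 1
    le = subst₂ ℕ._≤_ (sym (trans (ℕP.*-identityˡ _) (cong suc (ℕP.+-identityʳ d)))) (sym (ℕP.*-identityʳ _))
      (ℕ.s≤s (ℕP.≤-trans (ℕP.m≤m*n d (suc n)) (ℕP.m≤n+m _ n)))

  p≤ι : ∀ p → ∃[ b ] p ≤ ι (suc b)
  p≤ι p@(mkℚ n d c) = ℤ.∣ n ∣ , toℚᵘ-cancel-≤ (ℚᵘP.≤-respʳ-≃ (ℚᵘP.≃-sym (ι≃ (suc ℤ.∣ n ∣)))
    (ℚᵘ.*≤* (ℤP.≤-trans (ℤP.*-monoʳ-≤-nonNeg (+ 1) {n} {+ suc ℤ.∣ n ∣} n≤)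
      (ℤP.*-monoˡ-≤-nonNeg (+ suc ℤ.∣ n ∣) {+ 1} {+ suc d} (ℤ.+≤+ (ℕ.s≤s ℕ.z≤n))))))
    where
    n≤ : n ℤ.≤ + suc ℤ.∣ n ∣
    n≤ = ∣∣-bound n
      where
      ∣∣-bound : ∀ i → i ℤ.≤ + suc ℤ.∣ i ∣
      ∣∣-bound (+ m) = ℤ.+≤+ (ℕP.n≤1+n m)
      ∣∣-bound (ℤ.-[1+ m ]) = ℤ.-≤+

  0<½^ : ∀ n → 0ℚ < ½ ^ n
  0<½^ zero = 0<1
  0<½^ (suc n) = pos*pos (positive⁻¹ ½) (0<½^ n)

  ½^n*n≤1 : ∀ n → ½ ^ n * ι n ≤ 1ℚ
  ½^n*n≤1 zero = ≤-trans (≤-reflexive (*-zeroʳ 1ℚ)) (<⇒≤ 0<1)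
  ½^n*n≤1 (suc zero) = ℚ.*≤* (ℤ.+≤+ (ℕ.s≤s ℕ.z≤n))
  ½^n*n≤1 (suc n@(suc n′)) = begin
    ½ * ½ ^ n * ι (suc n)    ≤⟨ *-monoˡ (<⇒≤ (0<½^ (suc n))) (ι-mono (ℕ.s≤s (ℕP.≤-trans (ℕ.s≤s (ℕP.m≤n+m n′ n′)) (ℕP.≤-reflexive (sym (ℕP.+-suc n′ n′)))))) ⟩
    ½ * ½ ^ n * ι (n ℕ.+ n)  ≡⟨ cong (½ * ½ ^ n *_) (ι-+ n n) ⟩
    ½ * ½ ^ n * (ι n + ι n)  ≡⟨ solve 2 (λ a b → con ½ :* a :* (b :+ b) := a :* b) refl (½ ^ n) (ι n) ⟩
    ½ ^ n * ι n              ≤⟨ ½^n*n≤1 n ⟩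
    1ℚ ∎
    where open ≤-Reasoning

  ½^-small : ∀ ε → 0ℚ < ε → ∃[ N ] (∀ n → N ℕ.≤ n → ½ ^ n ≤ ε)
  ½^-small ε 0<ε = ↧ₙ ε , λ n N≤n → begin
    ½ ^ n                      ≡⟨ sym (*-identityʳ _) ⟩
    ½ ^ n * 1ℚ                 ≤⟨ *-monoˡ (<⇒≤ (0<½^ n)) (ε*↧ε≥1 ε 0<ε) ⟩
    ½ ^ n * (ι (↧ₙ ε) * ε)     ≤⟨ *-monoˡ (<⇒≤ (0<½^ n)) (*-monoʳ (<⇒≤ 0<ε) (ι-mono N≤n)) ⟩
    ½ ^ n * (ι n * ε)          ≡⟨ sym (*-assoc (½ ^ n) (ι n) ε) ⟩
    ½ ^ n * ι n * ε            ≤⟨ *-monoʳ (<⇒≤ 0<ε) (½^n*n≤1 n) ⟩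
    1ℚ * ε                     ≡⟨ *-identityˡ ε ⟩
    ε ∎
    where open ≤-Reasoning

IsCauchy : (ℕ → ℚ) → Set
IsCauchy u = ∀ ε → 0ℚ < ε → ∃[ N ] (∀ m n → N ℕ.≤ m → N ℕ.≤ n → ∣ u m - u n ∣ ≤ ε)

record ℝ : Set where
  constructor mkℝ
  field
    seq    : ℕ → ℚ
    cauchy : IsCauchy seq
open ℝ public

infix 4 _≈ᴿ_ _<ᴿ_
infixl 6 _+ᴿ_
infixl 7 _*ᴿ_
infix 8 -ᴿ_

record _≈ᴿ_ (x y : ℝ) : Set where
  constructor mk≈
  field
    close : ∀ ε → 0ℚ < ε → ∃[ N ] (∀ n → N ℕ.≤ n → ∣ seq x n - seq y n ∣ ≤ ε)
open _≈ᴿ_ public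

_<ᴿ_ : ℝ → ℝ → Set
x <ᴿ y = ∃[ ε ] (0ℚ < ε × ∃[ N ] (∀ n → N ℕ.≤ n → seq x n + ε ≤ seq y n))

module CauchyAux where
  open Aux

  ∣p-p∣≡0 : ∀ p → ∣ p - p ∣ ≡ 0ℚ
  ∣p-p∣≡0 p = cong ∣_∣ (+-inverseʳ p)

  -- It suffices to bound the differences by K·ε for a fixed K > 0.
  cauchy-K : ∀ {u} K → 0ℚ < K →
    (∀ ε → 0ℚ < ε → ∃[ N ] (∀ m n → N ℕ.≤ m → N ℕ.≤ n → ∣ u m - u n ∣ ≤ K * ε)) → IsCauchy u
  cauchy-K {u} K 0<K h ε 0<ε = proj₁ hh , λ m n a b → ≤-trans (proj₂ hh m n a b) (≤-reflexive eq)
    where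
    instance _ = ℚ.positive 0<K
    instance _ = pos⇒nonZero K
    hh = h (1/ K * ε) (pos*pos (positive⁻¹ (1/ K) {{1/pos⇒pos K}}) 0<ε)
    eq : K * (1/ K * ε) ≡ ε
    eq = trans (sym (*-assoc K (1/ K) ε)) (trans (cong (_* ε) (*-inverseʳ K)) (*-identityˡ ε))

  eventually-bounded : ∀ {u} → IsCauchy u → ∃[ B ] ∃[ N ] (∀ n → N ℕ.≤ n → ∣ u n ∣ ≤ ι (suc B))
  eventually-bounded {u} c = proj₁ bd , N , λ n N≤n → begin
    ∣ u n ∣                        ≡⟨ cong ∣_∣ (solve 2 (λ a b → a := (a :- b) :+ b) refl (u n) (u N)) ⟩
    ∣ (u n - u N) + u N ∣          ≤⟨ ∣p+q∣≤∣p∣+∣q∣ (u n - u N) (u N) ⟩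
    ∣ u n - u N ∣ + ∣ u N ∣        ≤⟨ +-monoˡ-≤ ∣ u N ∣ (proj₂ c1 n N N≤n ℕP.≤-refl) ⟩
    1ℚ + ∣ u N ∣                   ≤⟨ proj₂ bd ⟩
    ι (suc (proj₁ bd)) ∎
    where
    open ≤-Reasoning
    c1 = c 1ℚ 0<1
    N = proj₁ c1
    bd = p≤ι (1ℚ + ∣ u N ∣)

  abstract
    const-cauchy : ∀ p → IsCauchy (λ _ → p)
    const-cauchy p ε 0<ε = 0 , λ _ _ _ _ → ≤-trans (≤-reflexive (∣p-p∣≡0 p)) (<⇒≤ 0<ε)

  abstract
    +-cauchy : ∀ {u v} → IsCauchy u → IsCauchy v → IsCauchy (λ n → u n + v n)
    +-cauchy {u} {v} cu cv = cauchy-K {λ n → u n + v n} (1ℚ + 1ℚ) (positive⁻¹ (1ℚ + 1ℚ)) λ ε 0<ε →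
      let (M , hu) = cu ε 0<ε ; (N , hv) = cv ε 0<ε in
      M ℕ.⊔ N , λ m n a b → begin
        ∣ (u m + v m) - (u n + v n) ∣  ≡⟨ cong ∣_∣ (solve 4 (λ a b c d → (a :+ b) :- (c :+ d) := (a :- c) :+ (b :- d)) refl (u m) (v m) (u n) (v n)) ⟩
        ∣ (u m - u n) + (v m - v n) ∣  ≤⟨ ∣p+q∣≤∣p∣+∣q∣ (u m - u n) (v m - v n) ⟩
        ∣ u m - u n ∣ + ∣ v m - v n ∣  ≤⟨ +-mono-≤ (hu m n (ℕP.m⊔n≤o⇒m≤o M N a) (ℕP.m⊔n≤o⇒m≤o M N b)) (hv m n (ℕP.m⊔n≤o⇒n≤o M N a) (ℕP.m⊔n≤o⇒n≤o M N b)) ⟩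
        ε + ε                          ≡⟨ solve 1 (λ a → a :+ a := (con 1ℚ :+ con 1ℚ) :* a) refl ε ⟩
        (1ℚ + 1ℚ) * ε ∎
      where open ≤-Reasoning

  abstract
    neg-cauchy : ∀ {u} → IsCauchy u → IsCauchy (λ n → - u n)
    neg-cauchy {u} cu ε 0<ε = proj₁ (cu ε 0<ε) , λ m n a b → subst (_≤ ε)
      (trans (sym (∣-p∣≡∣p∣ (u m - u n))) (cong ∣_∣ (solve 2 (λ a b → :- (a :- b) := (:- a) :- (:- b)) refl (u m) (u n))))
      (proj₂ (cu ε 0<ε) m n a b)

  abstract
    *-cauchy : ∀ {u v} → IsCauchy u → IsCauchy v → IsCauchy (λ n → u n * v n)
    *-cauchy {u} {v} cu cv =
      let (A , N₁ , bu) = eventually-bounded {u} cu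
          (B , N₂ , bv) = eventually-bounded {v} cv in
      cauchy-K {λ n → u n * v n} (ι (suc A) + ι (suc B)) (+-mono-< (0<ι (suc A)) (0<ι (suc B))) λ ε 0<ε →
      let (N₃ , hu) = cu ε 0<ε ; (N₄ , hv) = cv ε 0<ε in
      (N₁ ℕ.⊔ N₂) ℕ.⊔ (N₃ ℕ.⊔ N₄) , λ m n a b →
      let a₁₂ = ℕP.m⊔n≤o⇒m≤o (N₁ ℕ.⊔ N₂) (N₃ ℕ.⊔ N₄) a
          b₁₂ = ℕP.m⊔n≤o⇒m≤o (N₁ ℕ.⊔ N₂) (N₃ ℕ.⊔ N₄) b
          a₃₄ = ℕP.m⊔n≤o⇒n≤o (N₁ ℕ.⊔ N₂) (N₃ ℕ.⊔ N₄) a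
          b₃₄ = ℕP.m⊔n≤o⇒n≤o (N₁ ℕ.⊔ N₂) (N₃ ℕ.⊔ N₄) b in begin
        ∣ u m * v m - u n * v n ∣  ≡⟨ cong ∣_∣ (solve 4 (λ a b c d → a :* b :- c :* d := a :* (b :- d) :+ (a :- c) :* d) refl (u m) (v m) (u n) (v n)) ⟩
        ∣ u m * (v m - v n) + (u m - u n) * v n ∣  ≤⟨ ∣p+q∣≤∣p∣+∣q∣ (u m * (v m - v n)) ((u m - u n) * v n) ⟩
        ∣ u m * (v m - v n) ∣ + ∣ (u m - u n) * v n ∣  ≡⟨ cong₂ _+_ (∣p*q∣≡∣p∣*∣q∣ (u m) (v m - v n)) (∣p*q∣≡∣p∣*∣q∣ (u m - u n) (v n)) ⟩
        ∣ u m ∣ * ∣ v m - v n ∣ + ∣ u m - u n ∣ * ∣ v n ∣  ≤⟨ +-mono-≤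
            (*-mono-nn (0≤∣p∣ (u m)) (<⇒≤ 0<ε) (bu m (ℕP.m⊔n≤o⇒m≤o N₁ N₂ a₁₂)) (hv m n (ℕP.m⊔n≤o⇒n≤o N₃ N₄ a₃₄) (ℕP.m⊔n≤o⇒n≤o N₃ N₄ b₃₄)))
            (*-mono-nn (0≤∣p∣ (u m - u n)) (0≤ι (suc B)) (hu m n (ℕP.m⊔n≤o⇒m≤o N₃ N₄ a₃₄) (ℕP.m⊔n≤o⇒m≤o N₃ N₄ b₃₄)) (bv n (ℕP.m⊔n≤o⇒n≤o N₁ N₂ b₁₂))) ⟩
        ι (suc A) * ε + ε * ι (suc B)  ≡⟨ solve 3 (λ a b e → a :* e :+ e :* b := (a :+ b) :* e) refl (ι (suc A)) (ι (suc B)) ε ⟩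
        (ι (suc A) + ι (suc B)) * ε ∎
      where open ≤-Reasoning

open CauchyAux using (const-cauchy; +-cauchy; neg-cauchy; *-cauchy)

fromℚ : ℚ → ℝ
fromℚ p = mkℝ (λ _ → p) (const-cauchy p)

0ᴿ 1ᴿ : ℝ
0ᴿ = fromℚ 0ℚ
1ᴿ = fromℚ 1ℚ

_+ᴿ_ _*ᴿ_ : ℝ → ℝ → ℝ
x +ᴿ y = mkℝ (λ n → seq x n + seq y n) (+-cauchy {seq x} {seq y} (cauchy x) (cauchy y))
x *ᴿ y = mkℝ (λ n → seq x n * seq y n) (*-cauchy {seq x} {seq y} (cauchy x) (cauchy y))

-ᴿ_ : ℝ → ℝ
-ᴿ x = mkℝ (λ n → - seq x n) (neg-cauchy {seq x} (cauchy x))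

-- Reciprocal on ℚ with the junk value 0 at 0, which below only occurs at finitely many indices.
recip : ℚ → ℚ
recip p with p ≟ 0ℚ
... | yes _   = 0ℚ
... | no  p≢0 = (1/ p) {{ℚ.≢-nonZero p≢0}}

module RecipAux where
  open Aux
  open CauchyAux

  recip-* : ∀ p → p ≢ 0ℚ → recip p * p ≡ 1ℚ
  recip-* p p≢0 with p ≟ 0ℚ
  ... | yes p≡0 = contradiction p≡0 p≢0
  ... | no  q   = *-inverseˡ p {{ℚ.≢-nonZero q}}

  <⇒≢0 : ∀ {p} → 0ℚ < p → p ≢ 0ℚ
  <⇒≢0 0<p p≡0 = <⇒≢ 0<p (sym p≡0)

  0≤recip : ∀ p → 0ℚ < p → 0ℚ ≤ recip p
  0≤recip p 0<p with p ≟ 0ℚ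
  ... | yes _ = ≤-refl
  ... | no  q = <⇒≤ (positive⁻¹ _ {{1/pos⇒pos p {{ℚ.positive 0<p}}}})

  recip-anti : ∀ δ p → 0ℚ < δ → δ ≤ p → recip p ≤ recip δ
  recip-anti δ p 0<δ δ≤p = begin
    recip p                    ≡⟨ sym (trans (cong (recip p *_) (recip-* δ (<⇒≢0 0<δ))) (*-identityʳ _)) ⟩
    recip p * (recip δ * δ)    ≤⟨ *-monoˡ (0≤recip p 0<p) (*-monoˡ (0≤recip δ 0<δ) δ≤p) ⟩
    recip p * (recip δ * p)    ≡⟨ solve 3 (λ a b c → a :* (b :* c) := b :* (a :* c)) refl (recip p) (recip δ) p ⟩
    recip δ * (recip p * p)    ≡⟨ trans (cong (recip δ *_) (recip-* p (<⇒≢0 0<p))) (*-identityʳ _) ⟩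
    recip δ ∎
    where
    open ≤-Reasoning
    0<p = <-≤-trans 0<δ δ≤p

  recip-diff : ∀ p q → 0ℚ < p → 0ℚ < q → recip p - recip q ≡ recip p * recip q * (q - p)
  recip-diff p q 0<p 0<q = sym (begin
    rp * rq * (q - p)                ≡⟨ solve 4 (λ a b c d → a :* b :* (d :- c) := a :* (b :* d) :- b :* (a :* c)) refl rp rq p q ⟩
    rp * (rq * q) - rq * (rp * p)    ≡⟨ cong₂ (λ s t → rp * s - rq * t) (recip-* q (<⇒≢0 0<q)) (recip-* p (<⇒≢0 0<p)) ⟩
    rp * 1ℚ - rq * 1ℚ                ≡⟨ cong₂ _-_ (*-identityʳ rp) (*-identityʳ rq) ⟩
    rp - rq ∎)
    where
    open ≡-Reasoning
    rp = recip p
    rq = recip q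

  abstract
    recip-cauchy : ∀ {u} → IsCauchy u → ∀ δ → 0ℚ < δ → ∀ N → (∀ n → N ℕ.≤ n → δ ≤ u n) → IsCauchy (λ n → recip (u n))
    recip-cauchy {u} cu δ 0<δ N δ≤ = cauchy-K {λ n → recip (u n)} (R * R) (pos*pos 0<R 0<R) λ ε 0<ε →
      let (M , hu) = cu ε 0<ε in
      M ℕ.⊔ N , λ m n a b →
      let δ≤m = δ≤ m (ℕP.m⊔n≤o⇒n≤o M N a)
          δ≤n = δ≤ n (ℕP.m⊔n≤o⇒n≤o M N b)
          0≤m = 0≤recip (u m) (<-≤-trans 0<δ δ≤m)
          0≤n = 0≤recip (u n) (<-≤-trans 0<δ δ≤n) in begin
        ∣ recip (u m) - recip (u n) ∣               ≡⟨ cong ∣_∣ (recip-diff (u m) (u n) (<-≤-trans 0<δ δ≤m) (<-≤-trans 0<δ δ≤n)) ⟩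
        ∣ recip (u m) * recip (u n) * (u n - u m) ∣ ≡⟨ ∣p*q∣≡∣p∣*∣q∣ (recip (u m) * recip (u n)) (u n - u m) ⟩
        ∣ recip (u m) * recip (u n) ∣ * ∣ u n - u m ∣ ≡⟨ cong (_* ∣ u n - u m ∣) (0≤p⇒∣p∣≡p (nn*nn 0≤m 0≤n)) ⟩
        recip (u m) * recip (u n) * ∣ u n - u m ∣   ≤⟨ *-mono-nn (nn*nn 0≤m 0≤n) (<⇒≤ 0<ε)
            (*-mono-nn 0≤m (<⇒≤ 0<R) (recip-anti δ (u m) 0<δ δ≤m) (recip-anti δ (u n) 0<δ δ≤n))
            (hu n m (ℕP.m⊔n≤o⇒m≤o M N b) (ℕP.m⊔n≤o⇒m≤o M N a)) ⟩
        R * R * ε ∎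
      where
      open ≤-Reasoning
      R : ℚ
      R = recip δ
      0<R : 0ℚ < R
      0<R = ≤∧≢⇒< (0≤recip δ 0<δ) λ 0≡R →
        <⇒≢ 0<1 (trans (sym (*-zeroˡ δ)) (trans (cong (_* δ) 0≡R) (recip-* δ (<⇒≢0 0<δ))))
        where
        ≤∧≢⇒< : ∀ {p q} → p ≤ q → p ≢ q → p < q
        ≤∧≢⇒< {p} {q} p≤q p≢q with p ℚ.<? q
        ... | yes p<q = p<q
        ... | no  p≮q = contradiction (≤-antisym p≤q (≮⇒≥ p≮q)) p≢q

recipᴿ : (x : ℝ) → 0ᴿ <ᴿ x → ℝ
recipᴿ x (ε , 0<ε , N , h) = mkℝ (λ n → recip (seq x n))
  (RecipAux.recip-cauchy {seq x} (cauchy x) ε 0<ε N λ n a → subst (_≤ seq x n) (+-identityˡ ε) (h n a))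

∑< : ℕ → (ℕ → ℚ) → ℚ
∑< zero    f = 0ℚ
∑< (suc n) f = ∑< n f + f n

1/! : ℕ → ℚ
1/! n = (+ 1 / (n !)) {{n ℕP.!≢0}}

cosTerm sinTerm : ℚ → ℕ → ℚ
cosTerm x k = (- 1ℚ) ^ k * (x ^ (2 ℕ.* k) * 1/! (2 ℕ.* k))
sinTerm x k = (- 1ℚ) ^ k * (x ^ (2 ℕ.* k ℕ.+ 1) * 1/! (2 ℕ.* k ℕ.+ 1))

module SeriesAux where
  open Aux
  open CauchyAux

  0≤^ : ∀ {p} → 0ℚ ≤ p → ∀ n → 0ℚ ≤ p ^ n
  0≤^ 0≤p zero    = <⇒≤ 0<1
  0≤^ 0≤p (suc n) = nn*nn 0≤p (0≤^ 0≤p n)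

  ∣^∣-mono : ∀ {x b} → ∣ x ∣ ≤ b → ∀ n → ∣ x ^ n ∣ ≤ b ^ n
  ∣^∣-mono x≤b zero = ≤-refl
  ∣^∣-mono {x} {b} x≤b (suc n) = ≤-trans (≤-reflexive (∣p*q∣≡∣p∣*∣q∣ x (x ^ n)))
    (*-mono-nn (0≤∣p∣ x) (0≤^ 0≤b n) x≤b (∣^∣-mono x≤b n))
    where 0≤b = ≤-trans (0≤∣p∣ x) x≤b

  ^-lipschitz : ∀ {x y b} → 1ℚ ≤ b → ∣ x ∣ ≤ b → ∣ y ∣ ≤ b → ∀ n →
    ∣ x ^ n - y ^ n ∣ ≤ ∣ x - y ∣ * (b + b) ^ n
  ^-lipschitz {x} {y} {b} 1≤b x≤b y≤b zero = ≤-trans (≤-reflexive (∣p-p∣≡0 1ℚ)) (nn*nn (0≤∣p∣ (x - y)) (<⇒≤ 0<1))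
  ^-lipschitz {x} {y} {b} 1≤b x≤b y≤b (suc n) = begin
    ∣ x * x ^ n - y * y ^ n ∣
      ≡⟨ cong ∣_∣ (solve 4 (λ x y u v → x :* u :- y :* v := x :* (u :- v) :+ (x :- y) :* v) refl x y (x ^ n) (y ^ n)) ⟩
    ∣ x * (x ^ n - y ^ n) + (x - y) * y ^ n ∣
      ≤⟨ ∣p+q∣≤∣p∣+∣q∣ (x * (x ^ n - y ^ n)) ((x - y) * y ^ n) ⟩
    ∣ x * (x ^ n - y ^ n) ∣ + ∣ (x - y) * y ^ n ∣
      ≡⟨ cong₂ _+_ (∣p*q∣≡∣p∣*∣q∣ x (x ^ n - y ^ n)) (∣p*q∣≡∣p∣*∣q∣ (x - y) (y ^ n)) ⟩
    ∣ x ∣ * ∣ x ^ n - y ^ n ∣ + ∣ x - y ∣ * ∣ y ^ n ∣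
      ≤⟨ +-mono-≤ (*-mono-nn (0≤∣p∣ x) (nn*nn 0≤d 0≤C) x≤b (^-lipschitz 1≤b x≤b y≤b n))
                  (*-monoˡ 0≤d (∣^∣-mono (≤-trans y≤b b≤b+b) n)) ⟩
    b * (∣ x - y ∣ * C) + ∣ x - y ∣ * C
      ≡⟨ solve 3 (λ b d c → b :* (d :* c) :+ d :* c := d :* ((b :+ con 1ℚ) :* c)) refl b ∣ x - y ∣ C ⟩
    ∣ x - y ∣ * ((b + 1ℚ) * C)
      ≤⟨ *-monoˡ 0≤d (*-monoʳ 0≤C (+-monoʳ-≤ b 1≤b)) ⟩
    ∣ x - y ∣ * ((b + b) * C) ∎
    where
    open ≤-Reasoning
    C = (b + b) ^ n
    0≤b = ≤-trans (<⇒≤ 0<1) 1≤b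
    0≤d = 0≤∣p∣ (x - y)
    b≤b+b : b ≤ b + b
    b≤b+b = ≤-trans (≤-reflexive (sym (+-identityʳ b))) (+-monoʳ-≤ b 0≤b)
    0≤C = 0≤^ (≤-trans 0≤b b≤b+b) n

  D^n≤D^D*n! : ∀ D .{{_ : NonZero D}} n → D ℕ.^ n ℕ.≤ D ℕ.^ D ℕ.* n !
  D^n≤D^D*n! D zero = ℕP.≤-trans (ℕP.m^n>0 D D) (ℕP.≤-reflexive (sym (ℕP.*-identityʳ _)))
  D^n≤D^D*n! D (suc n) with ℕP.≤-total (suc n) D
  ... | inj₁ n<D = ℕP.≤-trans (ℕP.^-monoʳ-≤ D n<D) (ℕP.m≤m*n _ (suc n !) {{suc n ℕP.!≢0}})
  ... | inj₂ D≤n = begin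
    D ℕ.* D ℕ.^ n                      ≤⟨ ℕP.*-mono-≤ D≤n (D^n≤D^D*n! D n) ⟩
    suc n ℕ.* (D ℕ.^ D ℕ.* n !)        ≡⟨ sym (ℕP.*-assoc (suc n) (D ℕ.^ D) (n !)) ⟩
    suc n ℕ.* D ℕ.^ D ℕ.* n !          ≡⟨ cong (ℕ._* n !) (ℕP.*-comm (suc n) (D ℕ.^ D)) ⟩
    D ℕ.^ D ℕ.* suc n ℕ.* n !          ≡⟨ ℕP.*-assoc (D ℕ.^ D) (suc n) (n !) ⟩
    D ℕ.^ D ℕ.* (suc n ℕ.* n !) ∎
    where open ℕP.≤-Reasoning

  0≤1/! : ∀ n → 0ℚ ≤ 1/! n
  0≤1/! n = nonNegative⁻¹ _ {{normalize-nonNeg 1 (n !) {{n ℕP.!≢0}}}}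

  ι-^ : ∀ D n → ι (D ℕ.^ n) ≡ ι D ^ n
  ι-^ D zero = refl
  ι-^ D (suc n) = trans (ι-* D (D ℕ.^ n)) (cong (ι D *_) (ι-^ D n))

  ^-distrib-* : ∀ p q n → (p * q) ^ n ≡ p ^ n * q ^ n
  ^-distrib-* p q zero = refl
  ^-distrib-* p q (suc n) = trans (cong (p * q *_) (^-distrib-* p q n))
    (solve 4 (λ p q a b → p :* q :* (a :* b) := p :* a :* (q :* b)) refl p q (p ^ n) (q ^ n))

  abstract
    -- With B = b + 1, (2B)ⁿ/n! ≤ E b · 2⁻ⁿ for all n.
    E : ℕ → ℚ
    E b = ι ((4 ℕ.* suc b) ℕ.^ (4 ℕ.* suc b))

    0<E : ∀ b → 0ℚ < E b
    0<E b = 0<ι ((4 ℕ.* suc b) ℕ.^ (4 ℕ.* suc b)) {{ℕP.m^n≢0 (4 ℕ.* suc b) (4 ℕ.* suc b)}}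

    [2B]^n/n!≤ : ∀ b n → (ι (suc b) + ι (suc b)) ^ n * 1/! n ≤ E b * ½ ^ n
    [2B]^n/n!≤ b n = begin
      (B + B) ^ n * 1/! n              ≡⟨ cong (λ t → t ^ n * 1/! n) (trans (solve 1 (λ a → a :+ a := con (ι 4) :* a :* con ½) refl B) (cong (_* ½) (sym (ι-* 4 (suc b))))) ⟩
      (ι D * ½) ^ n * 1/! n            ≡⟨ cong (_* 1/! n) (^-distrib-* (ι D) ½ n) ⟩
      ι D ^ n * ½ ^ n * 1/! n          ≡⟨ cong (λ t → t * ½ ^ n * 1/! n) (sym (ι-^ D n)) ⟩
      ι (D ℕ.^ n) * ½ ^ n * 1/! n      ≤⟨ *-monoʳ (0≤1/! n) (*-monoʳ (<⇒≤ (0<½^ n)) (≤-trans (ι-mono (D^n≤D^D*n! D n)) (≤-reflexive (ι-* (D ℕ.^ D) (n !))))) ⟩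
      E b * ι (n !) * ½ ^ n * 1/! n    ≡⟨ solve 4 (λ e f h i → e :* f :* h :* i := e :* h :* (i :* f)) refl (E b) (ι (n !)) (½ ^ n) (1/! n) ⟩
      E b * ½ ^ n * (1/! n * ι (n !))  ≡⟨ trans (cong (E b * ½ ^ n *_) (1/ι (n !) {{n ℕP.!≢0}})) (*-identityʳ _) ⟩
      E b * ½ ^ n ∎
      where
      open ≤-Reasoning
      B : ℚ
      B = ι (suc b)
      D : ℕ
      D = 4 ℕ.* suc b

  ½^-anti : ∀ {m n} → m ℕ.≤ n → ½ ^ n ≤ ½ ^ m
  ½^-anti {m} m≤n = go (ℕP.≤⇒≤′ m≤n)
    where
    go : ∀ {n} → m ℕ.≤′ n → ½ ^ n ≤ ½ ^ m
    go ℕ.≤′-refl = ≤-refl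
    go (ℕ.≤′-step {n} p) = ≤-trans (≤-trans (*-monoʳ {½ ^ n} {½} {1ℚ} (<⇒≤ (0<½^ n)) (ℚ.*≤* (ℤ.+≤+ (ℕ.s≤s ℕ.z≤n)))) (≤-reflexive (*-identityˡ _))) (go p)

  ∣[-1]^k*p∣ : ∀ k p → ∣ (- 1ℚ) ^ k * p ∣ ≡ ∣ p ∣
  ∣[-1]^k*p∣ zero p = cong ∣_∣ (*-identityˡ p)
  ∣[-1]^k*p∣ (suc k) p = trans (cong ∣_∣ (solve 2 (λ a p → :- con 1ℚ :* a :* p := :- (a :* p)) refl ((- 1ℚ) ^ k) p))
    (trans (∣-p∣≡∣p∣ ((- 1ℚ) ^ k * p)) (∣[-1]^k*p∣ k p))

  record Entire (t : ℚ → ℕ → ℚ) : Set where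
    field
      bound : ∀ b x k → ∣ x ∣ ≤ ι (suc b) → ∣ t x k ∣ ≤ E b * ½ ^ k
      lipschitz : ∀ b x y k → ∣ x ∣ ≤ ι (suc b) → ∣ y ∣ ≤ ι (suc b) →
        ∣ t x k - t y k ∣ ≤ ∣ x - y ∣ * (E b * ½ ^ k)

  monomials-entire : ∀ (e : ℕ → ℕ) → (∀ k → k ℕ.≤ e k) → Entire (λ x k → (- 1ℚ) ^ k * (x ^ e k * 1/! (e k)))
  monomials-entire e k≤e = record { bound = bd ; lipschitz = lp }
    where
    open ≤-Reasoning
    bd : ∀ b x k → ∣ x ∣ ≤ ι (suc b) → ∣ (- 1ℚ) ^ k * (x ^ e k * 1/! (e k)) ∣ ≤ E b * ½ ^ k
    bd b x k x≤ = begin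
      ∣ (- 1ℚ) ^ k * (x ^ e k * 1/! (e k)) ∣  ≡⟨ ∣[-1]^k*p∣ k _ ⟩
      ∣ x ^ e k * 1/! (e k) ∣               ≡⟨ ∣p*q∣≡∣p∣*∣q∣ (x ^ e k) (1/! (e k)) ⟩
      ∣ x ^ e k ∣ * ∣ 1/! (e k) ∣           ≡⟨ cong (∣ x ^ e k ∣ *_) (0≤p⇒∣p∣≡p (0≤1/! (e k))) ⟩
      ∣ x ^ e k ∣ * 1/! (e k)               ≤⟨ *-monoʳ (0≤1/! (e k)) (∣^∣-mono (≤-trans x≤ (≤-trans (≤-reflexive (sym (+-identityʳ _))) (+-monoʳ-≤ (ι (suc b)) (0≤ι (suc b))))) (e k)) ⟩
      (ι (suc b) + ι (suc b)) ^ e k * 1/! (e k) ≤⟨ [2B]^n/n!≤ b (e k) ⟩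
      E b * ½ ^ e k                        ≤⟨ *-monoˡ (<⇒≤ (0<E b)) (½^-anti (k≤e k)) ⟩
      E b * ½ ^ k ∎
    lp : ∀ b x y k → ∣ x ∣ ≤ ι (suc b) → ∣ y ∣ ≤ ι (suc b) →
      ∣ (- 1ℚ) ^ k * (x ^ e k * 1/! (e k)) - (- 1ℚ) ^ k * (y ^ e k * 1/! (e k)) ∣ ≤ ∣ x - y ∣ * (E b * ½ ^ k)
    lp b x y k x≤ y≤ = begin
      ∣ (- 1ℚ) ^ k * (x ^ e k * 1/! (e k)) - (- 1ℚ) ^ k * (y ^ e k * 1/! (e k)) ∣
        ≡⟨ cong ∣_∣ (solve 4 (λ a u v f → a :* (u :* f) :- a :* (v :* f) := a :* ((u :- v) :* f)) refl ((- 1ℚ) ^ k) (x ^ e k) (y ^ e k) (1/! (e k))) ⟩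
      ∣ (- 1ℚ) ^ k * ((x ^ e k - y ^ e k) * 1/! (e k)) ∣  ≡⟨ ∣[-1]^k*p∣ k _ ⟩
      ∣ (x ^ e k - y ^ e k) * 1/! (e k) ∣      ≡⟨ ∣p*q∣≡∣p∣*∣q∣ (x ^ e k - y ^ e k) (1/! (e k)) ⟩
      ∣ x ^ e k - y ^ e k ∣ * ∣ 1/! (e k) ∣    ≡⟨ cong (∣ x ^ e k - y ^ e k ∣ *_) (0≤p⇒∣p∣≡p (0≤1/! (e k))) ⟩
      ∣ x ^ e k - y ^ e k ∣ * 1/! (e k)        ≤⟨ *-monoʳ (0≤1/! (e k)) (^-lipschitz {x} {y} {ι (suc b)} (ι-mono {1} {suc b} (ℕ.s≤s ℕ.z≤n)) x≤ y≤ (e k)) ⟩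
      ∣ x - y ∣ * C * 1/! (e k)                ≡⟨ *-assoc ∣ x - y ∣ C (1/! (e k)) ⟩
      ∣ x - y ∣ * (C * 1/! (e k))              ≤⟨ *-monoˡ (0≤∣p∣ (x - y)) (≤-trans ([2B]^n/n!≤ b (e k)) (*-monoˡ (<⇒≤ (0<E b)) (½^-anti (k≤e k)))) ⟩
      ∣ x - y ∣ * (E b * ½ ^ k) ∎
      where C = (ι (suc b) + ι (suc b)) ^ e k

  cos-entire : Entire cosTerm
  cos-entire = monomials-entire (2 ℕ.*_) (λ k → ℕP.m≤m+n k _)

  sin-entire : Entire sinTerm
  sin-entire = monomials-entire (λ k → 2 ℕ.* k ℕ.+ 1) (λ k → ℕP.≤-trans (ℕP.m≤m+n k _) (ℕP.m≤m+n (2 ℕ.* k) 1))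

  2ℚ : ℚ
  2ℚ = 1ℚ + 1ℚ

  module _ {t : ℚ → ℕ → ℚ} (ent : Entire t) where
    open Entire ent

    ∑-lipschitz : ∀ b x y → ∣ x ∣ ≤ ι (suc b) → ∣ y ∣ ≤ ι (suc b) → ∀ n →
      ∣ ∑< n (t x) - ∑< n (t y) ∣ ≤ ∣ x - y ∣ * (E b * (2ℚ * (1ℚ - ½ ^ n)))
    ∑-lipschitz b x y x≤ y≤ zero = ≤-reflexive (sym (trans (cong (∣ x - y ∣ *_) (*-zeroʳ (E b))) (*-zeroʳ ∣ x - y ∣)))
    ∑-lipschitz b x y x≤ y≤ (suc n) = begin
      ∣ (∑< n (t x) + t x n) - (∑< n (t y) + t y n) ∣
        ≡⟨ cong ∣_∣ (solve 4 (λ a b c d → (a :+ b) :- (c :+ d) := (a :- c) :+ (b :- d)) refl (∑< n (t x)) (t x n) (∑< n (t y)) (t y n)) ⟩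
      ∣ (∑< n (t x) - ∑< n (t y)) + (t x n - t y n) ∣ ≤⟨ ∣p+q∣≤∣p∣+∣q∣ (∑< n (t x) - ∑< n (t y)) (t x n - t y n) ⟩
      ∣ ∑< n (t x) - ∑< n (t y) ∣ + ∣ t x n - t y n ∣ ≤⟨ +-mono-≤ (∑-lipschitz b x y x≤ y≤ n) (lipschitz b x y n x≤ y≤) ⟩
      d * (E b * (2ℚ * (1ℚ - ½ ^ n))) + d * (E b * ½ ^ n)
        ≡⟨ solve 3 (λ d e h → d :* (e :* (con 2ℚ :* (con 1ℚ :- h))) :+ d :* (e :* h) := d :* (e :* (con 2ℚ :* (con 1ℚ :- con ½ :* h)))) refl d (E b) (½ ^ n) ⟩
      d * (E b * (2ℚ * (1ℚ - ½ ^ suc n))) ∎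
      where
      open ≤-Reasoning
      d = ∣ x - y ∣

    ∑-tail : ∀ b x → ∣ x ∣ ≤ ι (suc b) → ∀ N {n} → N ℕ.≤′ n →
      ∣ ∑< n (t x) - ∑< N (t x) ∣ ≤ E b * (2ℚ * (½ ^ N - ½ ^ n))
    ∑-tail b x x≤ N ℕ.≤′-refl = ≤-reflexive (trans (∣p-p∣≡0 (∑< N (t x)))
      (solve 2 (λ e h → con 0ℚ := e :* (con 2ℚ :* (h :- h))) refl (E b) (½ ^ N)))
    ∑-tail b x x≤ N (ℕ.≤′-step {n} p) = begin
      ∣ (∑< n (t x) + t x n) - ∑< N (t x) ∣
        ≡⟨ cong ∣_∣ (solve 3 (λ a b c → (a :+ b) :- c := (a :- c) :+ b) refl (∑< n (t x)) (t x n) (∑< N (t x))) ⟩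
      ∣ (∑< n (t x) - ∑< N (t x)) + t x n ∣         ≤⟨ ∣p+q∣≤∣p∣+∣q∣ (∑< n (t x) - ∑< N (t x)) (t x n) ⟩
      ∣ ∑< n (t x) - ∑< N (t x) ∣ + ∣ t x n ∣       ≤⟨ +-mono-≤ (∑-tail b x x≤ N p) (bound b x n x≤) ⟩
      E b * (2ℚ * (½ ^ N - ½ ^ n)) + E b * ½ ^ n
        ≡⟨ solve 3 (λ e k h → e :* (con 2ℚ :* (k :- h)) :+ e :* h := e :* (con 2ℚ :* (k :- con ½ :* h))) refl (E b) (½ ^ N) (½ ^ n) ⟩
      E b * (2ℚ * (½ ^ N - ½ ^ suc n)) ∎
      where open ≤-Reasoning

    p-q≤p : ∀ p {q} → 0ℚ ≤ q → p - q ≤ p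
    p-q≤p p 0≤q = ≤-trans (+-monoʳ-≤ p (neg-antimono-≤ 0≤q)) (≤-reflexive (+-identityʳ p))

    0≤2 : 0ℚ ≤ 2ℚ
    0≤2 = nonNegative⁻¹ 2ℚ

    ∑-lipschitz′ : ∀ b x y → ∣ x ∣ ≤ ι (suc b) → ∣ y ∣ ≤ ι (suc b) → ∀ n →
      ∣ ∑< n (t x) - ∑< n (t y) ∣ ≤ ∣ x - y ∣ * (E b * 2ℚ)
    ∑-lipschitz′ b x y x≤ y≤ n = ≤-trans (∑-lipschitz b x y x≤ y≤ n)
      (*-monoˡ (0≤∣p∣ (x - y)) (*-monoˡ (<⇒≤ (0<E b))
        (≤-trans (*-monoˡ 0≤2 (p-q≤p 1ℚ (<⇒≤ (0<½^ n)))) (≤-reflexive (*-identityʳ 2ℚ)))))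

    ∑-tail′ : ∀ b x → ∣ x ∣ ≤ ι (suc b) → ∀ N n → N ℕ.≤ n →
      ∣ ∑< n (t x) - ∑< N (t x) ∣ ≤ E b * (2ℚ * ½ ^ N)
    ∑-tail′ b x x≤ N n N≤n = ≤-trans (∑-tail b x x≤ N (ℕP.≤⇒≤′ N≤n))
      (*-monoˡ (<⇒≤ (0<E b)) (*-monoˡ 0≤2 (p-q≤p (½ ^ N) (<⇒≤ (0<½^ n)))))

    abstract
      diagonal-cauchy : ∀ {u} → IsCauchy u → IsCauchy (λ n → ∑< n (t (u n)))
      diagonal-cauchy {u} cu =
        let (b , N₁ , u≤) = eventually-bounded {u} cu in
        cauchy-K {λ n → ∑< n (t (u n))} (E b * ι 6) (pos*pos (0<E b) (0<ι 6)) λ ε 0<ε →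
        let (N₂ , hu) = cu ε 0<ε ; (N₃ , h½) = ½^-small ε 0<ε
            N = N₁ ℕ.⊔ (N₂ ℕ.⊔ N₃)
            N₁≤ : ∀ {m} → N ℕ.≤ m → N₁ ℕ.≤ m
            N₁≤ = ℕP.m⊔n≤o⇒m≤o N₁ (N₂ ℕ.⊔ N₃)
            N₂≤ : ∀ {m} → N ℕ.≤ m → N₂ ℕ.≤ m
            N₂≤ le = ℕP.m⊔n≤o⇒m≤o N₂ N₃ (ℕP.m⊔n≤o⇒n≤o N₁ (N₂ ℕ.⊔ N₃) le)
            N₃≤N = ℕP.m⊔n≤o⇒n≤o N₂ N₃ (ℕP.m⊔n≤o⇒n≤o N₁ (N₂ ℕ.⊔ N₃) ℕP.≤-refl)
            tail : ∀ m → N ℕ.≤ m → ∣ ∑< m (t (u m)) - ∑< N (t (u m)) ∣ ≤ E b * (2ℚ * ε)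
            tail m le = ≤-trans (∑-tail′ b (u m) (u≤ m (N₁≤ le)) N m le)
              (*-monoˡ (<⇒≤ (0<E b)) (*-monoˡ 0≤2 (h½ N N₃≤N)))
            S = λ k m → ∑< k (t (u m))
        in N , λ m n p q → begin
          ∣ S m m - S n n ∣                                                  ≤⟨ |-|-trans (S m m) (S N m) (S n n) ⟩
          ∣ S m m - S N m ∣ + ∣ S N m - S n n ∣                              ≤⟨ +-monoʳ-≤ ∣ S m m - S N m ∣ (|-|-trans (S N m) (S N n) (S n n)) ⟩
          ∣ S m m - S N m ∣ + (∣ S N m - S N n ∣ + ∣ S N n - S n n ∣)        ≤⟨ +-mono-≤ (tail m p) (+-mono-≤
              (≤-trans (∑-lipschitz′ b (u m) (u n) (u≤ m (N₁≤ p)) (u≤ n (N₁≤ q)) N) (*-monoʳ (nn*nn (<⇒≤ (0<E b)) 0≤2) (hu m n (N₂≤ p) (N₂≤ q))))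
              (≤-trans (≤-reflexive (|-|-comm (S N n) (S n n))) (tail n q))) ⟩
          E b * (2ℚ * ε) + (ε * (E b * 2ℚ) + E b * (2ℚ * ε))
            ≡⟨ solve 2 (λ e h → e :* (con 2ℚ :* h) :+ (h :* (e :* con 2ℚ) :+ e :* (con 2ℚ :* h)) := e :* con (ι 6) :* h) refl (E b) ε ⟩
          E b * ι 6 * ε ∎
        where open ≤-Reasoning

-- The Taylor series is summed along the diagonal: the n-th approximation is the n-th partial sum
-- at the n-th rational approximation of x. `cos-isSum` and `sin-isSum` identify it with the series in ℝ.
cos sin : ℝ → ℝ
cos x = mkℝ (λ n → ∑< n (cosTerm (seq x n))) (SeriesAux.diagonal-cauchy SeriesAux.cos-entire {seq x} (cauchy x))
sin x = mkℝ (λ n → ∑< n (sinTerm (seq x n))) (SeriesAux.diagonal-cauchy SeriesAux.sin-entire {seq x} (cauchy x))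

infixr 8 _^ᴿ_

_^ᴿ_ : ℝ → ℕ → ℝ
x ^ᴿ zero  = 1ᴿ
x ^ᴿ suc n = x *ᴿ x ^ᴿ n

∑ᴿ< : ℕ → (ℕ → ℝ) → ℝ
∑ᴿ< zero    f = 0ᴿ
∑ᴿ< (suc n) f = ∑ᴿ< n f +ᴿ f n

_HasSum_ : (ℕ → ℝ) → ℝ → Set
f HasSum s = ∀ ε → 0ℚ < ε → ∃[ N ] (∀ n → N ℕ.≤ n →
  ∃[ M ] (∀ m → M ℕ.≤ m → ∣ seq (∑ᴿ< n f) m - seq s m ∣ ≤ ε))

module SumAux where
  open Aux
  open CauchyAux
  open SeriesAux

  seq-^ᴿ : ∀ x n m → seq (x ^ᴿ n) m ≡ seq x m ^ n
  seq-^ᴿ x zero    m = refl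
  seq-^ᴿ x (suc n) m = cong (seq x m *_) (seq-^ᴿ x n m)

  seq-∑ᴿ : ∀ {f g} m → (∀ k → seq (f k) m ≡ g k) → ∀ n → seq (∑ᴿ< n f) m ≡ ∑< n g
  seq-∑ᴿ m h zero    = refl
  seq-∑ᴿ m h (suc n) = cong₂ _+_ (seq-∑ᴿ m h n) (h n)

  ½^-small′ : ∀ K → 0ℚ < K → ∀ ε → 0ℚ < ε → ∃[ N ] (∀ n → N ℕ.≤ n → K * ½ ^ n ≤ ε)
  ½^-small′ K 0<K ε 0<ε = proj₁ h , λ n N≤n → ≤-trans (*-monoˡ (<⇒≤ 0<K) (proj₂ h n N≤n))
    (≤-reflexive (trans (sym (*-assoc K (1/ K) ε)) (trans (cong (_* ε) (*-inverseʳ K)) (*-identityˡ ε))))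
    where
    instance _ = ℚ.positive 0<K
    instance _ = pos⇒nonZero K
    h = ½^-small (1/ K * ε) (pos*pos (positive⁻¹ (1/ K) {{1/pos⇒pos K}}) 0<ε)

  module _ {t : ℚ → ℕ → ℚ} (ent : Entire t) (x : ℝ) (f : ℕ → ℝ) (s : ℝ)
    (hf : ∀ m k → seq (f k) m ≡ t (seq x m) k) (hs : ∀ n → seq s n ≡ ∑< n (t (seq x n))) where

    tail-bound : ∀ b m n → ∣ seq x m ∣ ≤ ι (suc b) → n ℕ.≤ m →
      ∣ seq (∑ᴿ< n f) m - seq s m ∣ ≤ E b * 2ℚ * ½ ^ n
    tail-bound b m n x≤ n≤m = begin
      ∣ seq (∑ᴿ< n f) m - seq s m ∣                    ≡⟨ cong₂ (λ p q → ∣ p - q ∣) (seq-∑ᴿ {f} {t (seq x m)} m (hf m) n) (hs m) ⟩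
      ∣ ∑< n (t (seq x m)) - ∑< m (t (seq x m)) ∣      ≡⟨ |-|-comm (∑< n (t (seq x m))) (∑< m (t (seq x m))) ⟩
      ∣ ∑< m (t (seq x m)) - ∑< n (t (seq x m)) ∣      ≤⟨ ∑-tail′ ent b (seq x m) x≤ n m n≤m ⟩
      E b * (2ℚ * ½ ^ n)                               ≡⟨ sym (*-assoc (E b) 2ℚ (½ ^ n)) ⟩
      E b * 2ℚ * ½ ^ n ∎
      where open ≤-Reasoning

    diagonal-isSum : f HasSum s
    diagonal-isSum ε 0<ε = go (eventually-bounded {seq x} (cauchy x))
      where
      Within : ℕ → ℕ → Set
      Within n m = ∣ seq (∑ᴿ< n f) m - seq s m ∣ ≤ ε
      go : ∃[ b ] ∃[ N₁ ] (∀ n → N₁ ℕ.≤ n → ∣ seq x n ∣ ≤ ι (suc b)) →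
        ∃[ N ] (∀ n → N ℕ.≤ n → ∃[ M ] (∀ m → M ℕ.≤ m → Within n m))
      go (b , N₁ , x≤) = proj₁ h , λ n N≤n → n ℕ.⊔ N₁ , λ m le →
        ≤-trans (tail-bound b m n (x≤ m (ℕP.m⊔n≤o⇒n≤o n N₁ le)) (ℕP.m⊔n≤o⇒m≤o n N₁ le)) (proj₂ h n N≤n)
        where
        h = ½^-small′ (E b * 2ℚ) (pos*pos (0<E b) (positive⁻¹ 2ℚ)) ε 0<ε

cos-isSum : ∀ x →
  (λ k → fromℚ ((- 1ℚ) ^ k) *ᴿ (x ^ᴿ (2 ℕ.* k) *ᴿ fromℚ (1/! (2 ℕ.* k)))) HasSum cos x
cos-isSum x = SumAux.diagonal-isSum SeriesAux.cos-entire x _ (cos x)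
  (λ m k → cong (λ p → (- 1ℚ) ^ k * (p * 1/! (2 ℕ.* k))) (SumAux.seq-^ᴿ x (2 ℕ.* k) m)) (λ _ → refl)

sin-isSum : ∀ x →
  (λ k → fromℚ ((- 1ℚ) ^ k) *ᴿ (x ^ᴿ (2 ℕ.* k ℕ.+ 1) *ᴿ fromℚ (1/! (2 ℕ.* k ℕ.+ 1)))) HasSum sin x
sin-isSum x = SumAux.diagonal-isSum SeriesAux.sin-entire x _ (sin x)
  (λ m k → cong (λ p → (- 1ℚ) ^ k * (p * 1/! (2 ℕ.* k ℕ.+ 1))) (SumAux.seq-^ᴿ x (2 ℕ.* k ℕ.+ 1) m)) (λ _ → refl)

-- π is the least positive zero of sin; this determines it up to _≈ᴿ_.
record IsPi (π : ℝ) : Set where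
  field
    0<π    : 0ᴿ <ᴿ π
    sinπ≈0 : sin π ≈ᴿ 0ᴿ
    least  : ∀ x → 0ᴿ <ᴿ x → x <ᴿ π → ¬ (sin x ≈ᴿ 0ᴿ)

infix 5 _+i_

record ℂ : Set where
  constructor _+i_
  field
    re im : ℝ
open ℂ public

infix 4 _≈ᶜ_ _≠0
infixl 6 _+ᶜ_
infixl 7 _*ᶜ_ _÷_[_]

_≈ᶜ_ : ℂ → ℂ → Set
z ≈ᶜ w = re z ≈ᴿ re w × im z ≈ᴿ im w

fromℝ : ℝ → ℂ
fromℝ x = x +i 0ᴿ

0ᶜ iᶜ : ℂ
0ᶜ = fromℝ 0ᴿ
iᶜ = 0ᴿ +i 1ᴿ

_+ᶜ_ _*ᶜ_ : ℂ → ℂ → ℂ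
z +ᶜ w = (re z +ᴿ re w) +i (im z +ᴿ im w)
z *ᶜ w = (re z *ᴿ re w +ᴿ -ᴿ (im z *ᴿ im w)) +i (re z *ᴿ im w +ᴿ im z *ᴿ re w)

∣_∣² : ℂ → ℝ
∣ z ∣² = re z *ᴿ re z +ᴿ im z *ᴿ im z

-- z ≠ 0 as apartness from 0, which is what division needs constructively.
_≠0 : ℂ → Set
z ≠0 = 0ᴿ <ᴿ ∣ z ∣²

recipᶜ : (z : ℂ) → z ≠0 → ℂ
recipᶜ z z≠0 = (re z *ᴿ t) +i (-ᴿ (im z *ᴿ t)) where t = recipᴿ ∣ z ∣² z≠0

_÷_[_] : ℂ → (w : ℂ) → w ≠0 → ℂ
z ÷ w [ w≠0 ] = z *ᶜ recipᶜ w w≠0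

module RootAux where
  open Aux
  open CauchyAux

  ≈-K : ∀ {x y} K → 0ℚ < K →
    (∀ ε → 0ℚ < ε → ∃[ N ] (∀ n → N ℕ.≤ n → ∣ seq x n - seq y n ∣ ≤ K * ε)) → x ≈ᴿ y
  close (≈-K {x} {y} K 0<K h) ε 0<ε = proj₁ hh , λ n a → ≤-trans (proj₂ hh n a) (≤-reflexive eq)
    where
    instance _ = ℚ.positive 0<K
    instance _ = pos⇒nonZero K
    hh = h (1/ K * ε) (pos*pos (positive⁻¹ (1/ K) {{1/pos⇒pos K}}) 0<ε)
    eq : K * (1/ K * ε) ≡ ε
    eq = trans (sym (*-assoc K (1/ K) ε)) (trans (cong (_* ε) (*-inverseʳ K)) (*-identityˡ ε))

  ≈-sym : ∀ {x y} → x ≈ᴿ y → y ≈ᴿ x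
  close (≈-sym {x} {y} h) ε 0<ε = proj₁ (close h ε 0<ε) , λ n a →
    ≤-trans (≤-reflexive (|-|-comm (seq y n) (seq x n))) (proj₂ (close h ε 0<ε) n a)

  +ᴿ-cong : ∀ {x x′ y y′} → x ≈ᴿ x′ → y ≈ᴿ y′ → x +ᴿ y ≈ᴿ x′ +ᴿ y′
  +ᴿ-cong {x} {x′} {y} {y′} p q = ≈-K {x +ᴿ y} {x′ +ᴿ y′} (1ℚ + 1ℚ) (positive⁻¹ (1ℚ + 1ℚ)) λ ε 0<ε →
    let (M , hp) = close p ε 0<ε ; (N , hq) = close q ε 0<ε in
    M ℕ.⊔ N , λ n a → begin
      ∣ (seq x n + seq y n) - (seq x′ n + seq y′ n) ∣    ≡⟨ cong ∣_∣ (solve 4 (λ a b c d → (a :+ b) :- (c :+ d) := (a :- c) :+ (b :- d)) refl (seq x n) (seq y n) (seq x′ n) (seq y′ n)) ⟩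
      ∣ (seq x n - seq x′ n) + (seq y n - seq y′ n) ∣    ≤⟨ ∣p+q∣≤∣p∣+∣q∣ (seq x n - seq x′ n) (seq y n - seq y′ n) ⟩
      ∣ seq x n - seq x′ n ∣ + ∣ seq y n - seq y′ n ∣    ≤⟨ +-mono-≤ (hp n (ℕP.m⊔n≤o⇒m≤o M N a)) (hq n (ℕP.m⊔n≤o⇒n≤o M N a)) ⟩
      ε + ε                                              ≡⟨ solve 1 (λ a → a :+ a := (con 1ℚ :+ con 1ℚ) :* a) refl ε ⟩
      (1ℚ + 1ℚ) * ε ∎
    where open ≤-Reasoning

  *ᴿ-cong : ∀ {x x′ y y′} → x ≈ᴿ x′ → y ≈ᴿ y′ → x *ᴿ y ≈ᴿ x′ *ᴿ y′
  *ᴿ-cong {x} {x′} {y} {y′} p q =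
    let (A , N₁ , bx) = eventually-bounded {seq x} (cauchy x)
        (B , N₂ , by) = eventually-bounded {seq y′} (cauchy y′) in
    ≈-K {x *ᴿ y} {x′ *ᴿ y′} (ι (suc A) + ι (suc B)) (+-mono-< (0<ι (suc A)) (0<ι (suc B))) λ ε 0<ε →
    let (N₃ , hp) = close p ε 0<ε ; (N₄ , hq) = close q ε 0<ε in
    (N₁ ℕ.⊔ N₂) ℕ.⊔ (N₃ ℕ.⊔ N₄) , λ n a →
    let a₁₂ = ℕP.m⊔n≤o⇒m≤o (N₁ ℕ.⊔ N₂) (N₃ ℕ.⊔ N₄) a
        a₃₄ = ℕP.m⊔n≤o⇒n≤o (N₁ ℕ.⊔ N₂) (N₃ ℕ.⊔ N₄) a
        u = seq x n ; u′ = seq x′ n ; v = seq y n ; v′ = seq y′ n in begin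
      ∣ u * v - u′ * v′ ∣  ≡⟨ cong ∣_∣ (solve 4 (λ a b c d → a :* b :- c :* d := a :* (b :- d) :+ (a :- c) :* d) refl u v u′ v′) ⟩
      ∣ u * (v - v′) + (u - u′) * v′ ∣  ≤⟨ ∣p+q∣≤∣p∣+∣q∣ (u * (v - v′)) ((u - u′) * v′) ⟩
      ∣ u * (v - v′) ∣ + ∣ (u - u′) * v′ ∣  ≡⟨ cong₂ _+_ (∣p*q∣≡∣p∣*∣q∣ u (v - v′)) (∣p*q∣≡∣p∣*∣q∣ (u - u′) v′) ⟩
      ∣ u ∣ * ∣ v - v′ ∣ + ∣ u - u′ ∣ * ∣ v′ ∣  ≤⟨ +-mono-≤
          (*-mono-nn (0≤∣p∣ u) (<⇒≤ 0<ε) (bx n (ℕP.m⊔n≤o⇒m≤o N₁ N₂ a₁₂)) (hq n (ℕP.m⊔n≤o⇒n≤o N₃ N₄ a₃₄)))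
          (*-mono-nn (0≤∣p∣ (u - u′)) (0≤ι (suc B)) (hp n (ℕP.m⊔n≤o⇒m≤o N₃ N₄ a₃₄)) (by n (ℕP.m⊔n≤o⇒n≤o N₁ N₂ a₁₂))) ⟩
      ι (suc A) * ε + ε * ι (suc B)  ≡⟨ solve 3 (λ a b e → a :* e :+ e :* b := (a :+ b) :* e) refl (ι (suc A)) (ι (suc B)) ε ⟩
      (ι (suc A) + ι (suc B)) * ε ∎
    where open ≤-Reasoning

  0<-resp-≈ : ∀ {x y} → x ≈ᴿ y → 0ᴿ <ᴿ x → 0ᴿ <ᴿ y
  0<-resp-≈ {x} {y} x≈y (ε , 0<ε , N , h) =
    let 0<ε/2 = pos*pos (positive⁻¹ ½) 0<ε
        (M , k) = close x≈y (½ * ε) 0<ε/2 in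
    ½ * ε , 0<ε/2 , M ℕ.⊔ N , λ n a → begin
      0ℚ + ½ * ε                        ≡⟨ solve 1 (λ e → con 0ℚ :+ con ½ :* e := (con 0ℚ :+ e) :- con ½ :* e) refl ε ⟩
      (0ℚ + ε) - ½ * ε                  ≤⟨ +-mono-≤ (h n (ℕP.m⊔n≤o⇒n≤o M N a)) (neg-antimono-≤ (k n (ℕP.m⊔n≤o⇒m≤o M N a))) ⟩
      seq x n - ∣ seq x n - seq y n ∣   ≤⟨ +-monoʳ-≤ (seq x n) (neg-antimono-≤ (p≤∣p∣ (seq x n - seq y n))) ⟩
      seq x n - (seq x n - seq y n)     ≡⟨ solve 2 (λ a b → a :- (a :- b) := b) refl (seq x n) (seq y n) ⟩
      seq y n ∎
    where open ≤-Reasoning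

  ∣∣²-cong : ∀ {z w} → z ≈ᶜ w → ∣ z ∣² ≈ᴿ ∣ w ∣²
  ∣∣²-cong {a +i b} {c +i d} (p , q) = +ᴿ-cong {a *ᴿ a} {c *ᴿ c} {b *ᴿ b} {d *ᴿ d}
    (*ᴿ-cong {a} {c} {a} {c} p p) (*ᴿ-cong {b} {d} {b} {d} q q)

  0≤p*p : ∀ p → 0ℚ ≤ p * p
  0≤p*p p with ≤-total 0ℚ p
  ... | inj₁ 0≤p = nn*nn 0≤p 0≤p
  ... | inj₂ p≤0 = subst (0ℚ ≤_) (solve 1 (λ p → (:- p) :* (:- p) := p :* p) refl p) (nn*nn (neg-antimono-≤ p≤0) (neg-antimono-≤ p≤0))

  ⊓≤sqrt : ∀ t ε → ε ≤ t * t → 0ℚ ≤ t → ε ℚ.⊓ 1ℚ ≤ t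
  ⊓≤sqrt t ε ε≤t² 0≤t with ε ℚ.⊓ 1ℚ ≤? t
  ... | yes p = p
  ... | no ¬p = contradiction (begin-strict
      ε             ≤⟨ ε≤t² ⟩
      t * t         ≤⟨ *-monoˡ 0≤t (≤-trans (<⇒≤ t<) (p⊓q≤q ε 1ℚ)) ⟩
      t * 1ℚ        ≡⟨ *-identityʳ t ⟩
      t             <⟨ t< ⟩
      ε ℚ.⊓ 1ℚ      ≤⟨ p⊓q≤p ε 1ℚ ⟩
      ε ∎) (<-irrefl refl)
    where
    open ≤-Reasoning
    t< = ≰⇒> ¬p

  0<⊓ : ∀ ε → 0ℚ < ε → 0ℚ < ε ℚ.⊓ 1ℚ
  0<⊓ ε 0<ε with ⊓-sel ε 1ℚ
  ... | inj₁ e = subst (0ℚ <_) (sym e) 0<ε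
  ... | inj₂ e = subst (0ℚ <_) (sym e) 0<1

abstract
  sqrt-≠0 : ∀ s w → s *ᶜ s ≈ᶜ w → w ≠0 → s ≠0
  sqrt-≠0 s w s²≈w w≠0 =
    let (ε , 0<ε , N , h) = 0<-resp-≈ {∣ w ∣²} {∣ s *ᶜ s ∣²} (≈-sym {∣ s *ᶜ s ∣²} {∣ w ∣²} (∣∣²-cong {s *ᶜ s} {w} s²≈w)) w≠0 in
    ε ℚ.⊓ 1ℚ , 0<⊓ ε 0<ε , N , λ n a →
      let x = seq (re s) n ; y = seq (im s) n in
      ≤-trans (≤-reflexive (+-identityˡ (ε ℚ.⊓ 1ℚ)))
        (⊓≤sqrt (x * x + y * y) ε
          (≤-trans (≤-reflexive (sym (+-identityˡ ε))) (≤-trans (h n a) (≤-reflexive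
            (solve 2 (λ x y → (x :* x :+ :- (y :* y)) :* (x :* x :+ :- (y :* y)) :+ (x :* y :+ y :* x) :* (x :* y :+ y :* x)
                            := (x :* x :+ y :* y) :* (x :* x :+ y :* y)) refl x y))))
          (+-mono-≤ (0≤p*p x) (0≤p*p y)))
    where
    open RootAux

-- Coefficient lists, constant term first; trailing zeros are allowed.
Poly : Set
Poly = List ℚ

Nonzero : Poly → Set
Nonzero = Any (_≢ 0ℚ)

-- The zero polynomial gets degree 0.
degree : Poly → ℕ
degree []      = 0
degree (a ∷ p) with any? (λ c → ¬? (c ≟ 0ℚ)) p
... | yes _ = suc (degree p)
... | no  _ = 0

infixl 6 _+ᴾ_
infixl 7 _*ᴾ_

_+ᴾ_ _*ᴾ_ : Poly → Poly → Poly
[]      +ᴾ q       = q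
(a ∷ p) +ᴾ []      = a ∷ p
(a ∷ p) +ᴾ (b ∷ q) = (a + b) ∷ (p +ᴾ q)

[]      *ᴾ q = []
(a ∷ p) *ᴾ q = map (a *_) q +ᴾ (0ℚ ∷ (p *ᴾ q))

eval : Poly → ℂ → ℂ
eval []      z = 0ᶜ
eval (a ∷ p) z = fromℝ (fromℚ a) +ᶜ z *ᶜ eval p z

ℱ : (d g : Poly) → ℕ → Poly
ℱ d g zero          = []
ℱ d g (suc zero)    = 1ℚ ∷ []
ℱ d g (suc (suc n)) = d *ᴾ ℱ d g (suc n) +ᴾ g *ᴾ ℱ d g n

γ : (π : ℝ) (n : ℕ) .{{_ : NonZero n}} → ℕ → ℂ
γ π n j = fromℝ (fromℚ (+ 2 / 1)) *ᶜ iᶜ *ᶜ fromℝ (cos (fromℚ (+ j / n) *ᴿ π))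

{-# OPTIONS --safe #-}
-- Write d(r) = 2i s cos θ with θ = jπ/n. Since g(r) = s², induction on the recurrence gives
-- ℱₖ₊₁(r) = (i s)ᵏ Uₖ(cos θ), with Uₖ the Chebyshev polynomials of the second kind. The identity
-- sin(x + y) + sin(x − y) = 2 cos y sin x gives sin(kθ) = sin θ · Uₖ₋₁(cos θ) for every θ, so that
-- sin(jπ) is a multiple of sin π, and sin θ · Uₙ₋₁(cos θ) = sin(nθ) = sin(jπ) = 0. As 0 < θ < π
-- only ¬ (sin θ ≈ 0) is known; this suffices because a real that cannot be apart from 0 is 0.
-- The addition theorem for sin comes from the Cauchy product of two truncated exponential
-- series, which misses the series of the sum by O(2⁻ⁿ) for bounded rational arguments.

module Submission where

import Data.Integer as ℤ
import Data.Integer.Properties as ℤP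
open import Data.List using ([]; _∷_; map)
open import Data.Nat as ℕ using (ℕ; zero; suc; NonZero; _!)
import Data.Nat.Properties as ℕP
open import Data.Product using (∃-syntax; _×_; _,_; proj₁; proj₂)
open import Data.Sum using (inj₁; inj₂)
open import Function using (_∘_)
open import Relation.Binary.PropositionalEquality
open import Relation.Nullary using (¬_; contradiction)
open import Defs

module RationalEstimates where
  open import Data.Rational hiding (NonZero)
  open import Data.Rational.Properties
  open import Data.Rational.Solver
  open import Data.Rational.Unnormalised using (mkℚᵘ; *≡*)
  import Data.Rational.Unnormalised.Properties as ℚᵘP
  open +-*-Solver using (solve; _:=_; _:+_; _:*_; :-_; _:-_; con)
  open Aux
  open SeriesAux

  -- Cauchy products of coefficient sequences and the binomial theorem

  -- This is the sum of `e a * f b` over a + b = m. Splitting off a = 0 and shifting `e` keeps the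
  -- recursion structural and avoids the index m - a.
  conv : (ℕ → ℚ) → (ℕ → ℚ) → ℕ → ℚ
  conv e f zero    = e 0 * f 0
  conv e f (suc m) = e 0 * f (suc m) + conv (e ∘ suc) f m

  conv-cong : ∀ {e e′ f f′} → (∀ a → e a ≡ e′ a) → (∀ b → f b ≡ f′ b) →
    ∀ m → conv e f m ≡ conv e′ f′ m
  conv-cong p q zero    = cong₂ _*_ (p 0) (q 0)
  conv-cong p q (suc m) = cong₂ _+_ (cong₂ _*_ (p 0) (q (suc m))) (conv-cong (p ∘ suc) q m)

  conv-+ˡ : ∀ e e′ f m → conv (λ a → e a + e′ a) f m ≡ conv e f m + conv e′ f m
  conv-+ˡ e e′ f zero    = *-distribʳ-+ (f 0) (e 0) (e′ 0)
  conv-+ˡ e e′ f (suc m) = trans (cong ((e 0 + e′ 0) * f (suc m) +_) (conv-+ˡ (e ∘ suc) (e′ ∘ suc) f m))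
    (solve 5 (λ a b x c d → (a :+ b) :* x :+ (c :+ d) := (a :* x :+ c) :+ (b :* x :+ d)) refl
      (e 0) (e′ 0) (f (suc m)) (conv (e ∘ suc) f m) (conv (e′ ∘ suc) f m))

  conv-*ˡ : ∀ k e f m → conv (λ a → k * e a) f m ≡ k * conv e f m
  conv-*ˡ k e f zero    = *-assoc k (e 0) (f 0)
  conv-*ˡ k e f (suc m) = trans (cong (k * e 0 * f (suc m) +_) (conv-*ˡ k (e ∘ suc) f m))
    (solve 4 (λ k a b c → k :* a :* b :+ k :* c := k :* (a :* b :+ c)) refl
      k (e 0) (f (suc m)) (conv (e ∘ suc) f m))

  conv-*ʳ : ∀ k e f m → conv e (λ b → k * f b) m ≡ k * conv e f m
  conv-*ʳ k e f zero    = solve 3 (λ k a b → a :* (k :* b) := k :* (a :* b)) refl k (e 0) (f 0)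
  conv-*ʳ k e f (suc m) = trans (cong (e 0 * (k * f (suc m)) +_) (conv-*ʳ k (e ∘ suc) f m))
    (solve 4 (λ k a b c → a :* (k :* b) :+ k :* c := k :* (a :* b :+ c)) refl
      k (e 0) (f (suc m)) (conv (e ∘ suc) f m))

  -- Coefficients of the derivative of the power series with coefficients e.
  D : (ℕ → ℚ) → ℕ → ℚ
  D e a = ι (suc a) * e (suc a)

  ι-suc : ∀ n → ι (suc n) ≡ 1ℚ + ι n
  ι-suc n = ι-+ 1 n

  D-suc : ∀ e a → D e (suc a) ≡ D (e ∘ suc) a + e (suc (suc a))
  D-suc e a = trans (cong (_* e (suc (suc a))) (ι-suc (suc a)))
    (solve 2 (λ i x → (con 1ℚ :+ i) :* x := i :* x :+ x) refl (ι (suc a)) (e (suc (suc a))))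

  -- Product rule for formal power series. In the step, one copy of `c₁` is split off from `i * c₁`,
  -- so that the rest is the derivative of the shifted product; by `D-suc` this extra copy is what
  -- turns `D (e ∘ suc)` into `D e ∘ suc`.
  leibniz : ∀ e f m → D (conv e f) m ≡ conv (D e) f m + conv e (D f) m
  leibniz e f zero = solve 4 (λ a b c d → con 1ℚ :* (a :* d :+ b :* c) := con 1ℚ :* b :* c :+ a :* (con 1ℚ :* d)) refl
    (e 0) (e 1) (f 0) (f 1)
  leibniz e f (suc m) = begin
    i * (e 0 * x + c₁)
      ≡⟨ solve 4 (λ i a x c → i :* (a :* x :+ c) := a :* (i :* x) :+ i :* c) refl i (e 0) x c₁ ⟩
    e 0 * (i * x) + i * c₁
      ≡⟨ cong (λ t → e 0 * (i * x) + t) (trans (cong (_* c₁) (ι-suc (suc m)))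
           (trans (solve 2 (λ i x → (con 1ℚ :+ i) :* x := x :+ i :* x) refl (ι (suc m)) c₁)
             (cong (c₁ +_) (leibniz (e ∘ suc) f m)))) ⟩
    e 0 * (i * x) + ((e 1 * f (suc m) + c₂) + (c₃ + c₄))
      ≡⟨ solve 6 (λ a b c₂ c₃ c₄ y → a :+ ((b :* y :+ c₂) :+ (c₃ :+ c₄)) := (con 1ℚ :* b :* y :+ (c₃ :+ c₂)) :+ (a :+ c₄))
           refl (e 0 * (i * x)) (e 1) c₂ c₃ c₄ (f (suc m)) ⟩
    (1ℚ * e 1 * f (suc m) + (c₃ + c₂)) + (e 0 * (i * x) + c₄)
      ≡⟨ cong (λ t → (1ℚ * e 1 * f (suc m) + t) + (e 0 * (i * x) + c₄))
           (sym (trans (conv-cong (D-suc e) (λ _ → refl) m) (conv-+ˡ (D (e ∘ suc)) (e ∘ suc ∘ suc) f m))) ⟩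
    (1ℚ * e 1 * f (suc m) + conv (D e ∘ suc) f m) + (e 0 * (i * x) + c₄) ∎
    where
    open ≡-Reasoning
    i = ι (suc (suc m))
    x = f (suc (suc m))
    c₁ = conv (e ∘ suc) f (suc m)
    c₂ = conv (e ∘ suc ∘ suc) f m
    c₃ = conv (D (e ∘ suc)) f m
    c₄ = conv (e ∘ suc) (D f) m

  expTerm : ℚ → ℕ → ℚ
  expTerm x m = x ^ m * 1/! m

  1/!-suc : ∀ m → ι (suc m) * 1/! (suc m) ≡ 1/! m
  1/!-suc m = begin
    ι (suc m) * 1/! (suc m)                          ≡⟨ sym (*-identityʳ _) ⟩
    ι (suc m) * 1/! (suc m) * 1ℚ                     ≡⟨ cong (ι (suc m) * 1/! (suc m) *_) (sym (1/ι (m !) {{m ℕP.!≢0}})) ⟩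
    ι (suc m) * 1/! (suc m) * (1/! m * ι (m !))      ≡⟨ solve 4 (λ i a b c → i :* a :* (b :* c) := b :* (a :* (i :* c))) refl (ι (suc m)) (1/! (suc m)) (1/! m) (ι (m !)) ⟩
    1/! m * (1/! (suc m) * (ι (suc m) * ι (m !)))    ≡⟨ cong (λ t → 1/! m * (1/! (suc m) * t)) (sym (ι-* (suc m) (m !))) ⟩
    1/! m * (1/! (suc m) * ι (suc m !))              ≡⟨ trans (cong (1/! m *_) (1/ι (suc m !) {{suc m ℕP.!≢0}})) (*-identityʳ _) ⟩
    1/! m ∎
    where open ≡-Reasoning

  D-expTerm : ∀ x m → D (expTerm x) m ≡ x * expTerm x m
  D-expTerm x m = trans
    (solve 4 (λ i x u f → i :* (x :* u :* f) := x :* (u :* (i :* f))) refl (ι (suc m)) x (x ^ m) (1/! (suc m)))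
    (cong (λ t → x * (x ^ m * t)) (1/!-suc m))

  -- The factor m + 1 that differentiation introduces is invertible in ℚ. This makes induction along
  -- a differential equation possible.
  D-injective : ∀ e f m → D e m ≡ D f m → e (suc m) ≡ f (suc m)
  D-injective e f m eq = trans (undo (e (suc m))) (trans (cong ((ℤ.+ 1 / suc m) *_) eq) (sym (undo (f (suc m)))))
    where
    undo : ∀ p → p ≡ (ℤ.+ 1 / suc m) * (ι (suc m) * p)
    undo p = sym (trans (sym (*-assoc (ℤ.+ 1 / suc m) (ι (suc m)) p)) (trans (cong (_* p) (1/ι (suc m))) (*-identityˡ p)))

  -- Both sides satisfy D h = (x + y) h.
  binomial : ∀ x y m → conv (expTerm x) (expTerm y) m ≡ expTerm (x + y) m
  binomial x y zero    = refl
  binomial x y (suc m) = D-injective (conv (expTerm x) (expTerm y)) (expTerm (x + y)) m (begin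
    D (conv e f) m                                      ≡⟨ leibniz e f m ⟩
    conv (D e) f m + conv e (D f) m                     ≡⟨ cong₂ _+_ (conv-cong (D-expTerm x) (λ _ → refl) m) (conv-cong {e} (λ _ → refl) (D-expTerm y) m) ⟩
    conv (λ a → x * e a) f m + conv e (λ b → y * f b) m ≡⟨ cong₂ _+_ (conv-*ˡ x e f m) (conv-*ʳ y e f m) ⟩
    x * conv e f m + y * conv e f m                     ≡⟨ sym (*-distribʳ-+ (conv e f m) x y) ⟩
    (x + y) * conv e f m                                ≡⟨ cong ((x + y) *_) (binomial x y m) ⟩
    (x + y) * expTerm (x + y) m                         ≡⟨ sym (D-expTerm (x + y) m) ⟩
    D (expTerm (x + y)) m ∎)
    where
    open ≡-Reasoning
    e = expTerm x
    f = expTerm y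

  -- Partial sums and the remainder of a Cauchy product

  ∑-suc : ∀ e n → ∑< (suc n) e ≡ e 0 + ∑< n (e ∘ suc)
  ∑-suc e zero    = +-comm 0ℚ (e 0)
  ∑-suc e (suc n) = trans (cong (_+ e (suc n)) (∑-suc e n)) (+-assoc (e 0) (∑< n (e ∘ suc)) (e (suc n)))

  ∑-cong : ∀ {e f} → (∀ k → e k ≡ f k) → ∀ n → ∑< n e ≡ ∑< n f
  ∑-cong p zero    = refl
  ∑-cong p (suc n) = cong₂ _+_ (∑-cong p n) (p n)

  ∑-+ : ∀ e f n → ∑< n (λ k → e k + f k) ≡ ∑< n e + ∑< n f
  ∑-+ e f zero    = refl
  ∑-+ e f (suc n) = trans (cong (_+ (e n + f n)) (∑-+ e f n))
    (solve 4 (λ a b c d → (a :+ b) :+ (c :+ d) := (a :+ c) :+ (b :+ d)) refl (∑< n e) (∑< n f) (e n) (f n))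

  ∑-neg : ∀ e n → ∑< n (λ k → - e k) ≡ - ∑< n e
  ∑-neg e zero    = refl
  ∑-neg e (suc n) = trans (cong (_+ - e n) (∑-neg e n)) (sym (neg-distrib-+ (∑< n e) (e n)))

  ∑-conv-suc : ∀ e f n → ∑< (suc n) (conv e f) ≡ e 0 * ∑< (suc n) f + ∑< n (conv (e ∘ suc) f)
  ∑-conv-suc e f zero    = solve 2 (λ a b → con 0ℚ :+ a :* b := a :* (con 0ℚ :+ b) :+ con 0ℚ) refl (e 0) (f 0)
  ∑-conv-suc e f (suc n) = trans (cong (_+ conv e f (suc n)) (∑-conv-suc e f n))
    (solve 5 (λ a b c d x → (a :* b :+ c) :+ (a :* x :+ d) := a :* (b :+ x) :+ (c :+ d)) refl
      (e 0) (∑< (suc n) f) (∑< n (conv (e ∘ suc) f)) (conv (e ∘ suc) f n) (f (suc n)))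

  -- The product of partial sums covers the square a, b < n, the sum of the convolutions only its
  -- part a + b < n. What remains is the sum of `e a * f b` over a, b < n with a + b ≥ n.
  rem : (ℕ → ℚ) → (ℕ → ℚ) → ℕ → ℚ
  rem e f n = ∑< n e * ∑< n f - ∑< n (conv e f)

  -- The row a = 0 lies wholly in the triangle and cancels. After the shift of `e`, the columns b <
  -- n form the smaller remainder and the column b = n contributes in full.
  rem-suc : ∀ e f n → rem e f (suc n) ≡ rem (e ∘ suc) f n + ∑< n (e ∘ suc) * f n
  rem-suc e f n = trans
    (cong₂ (λ s t → s * ∑< (suc n) f - t) (∑-suc e n) (∑-conv-suc e f n))
    (solve 5 (λ a s b x c → (a :+ s) :* (b :+ x) :- (a :* (b :+ x) :+ c) := (s :* b :- c) :+ s :* x) refl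
      (e 0) (∑< n (e ∘ suc)) (∑< n f) (f n) (∑< n (conv (e ∘ suc) f)))

  -- The factor 2(1 - 2⁻ⁿ) is the exact geometric sum, which lets the induction close.
  ∑-bound : ∀ {K e} → (∀ a → ∣ e a ∣ ≤ K * ½ ^ a) → ∀ n → ∣ ∑< n e ∣ ≤ K * (2ℚ * (1ℚ - ½ ^ n))
  ∑-bound {K} e≤ zero = ≤-reflexive (sym (*-zeroʳ K))
  ∑-bound {K} {e} e≤ (suc n) = begin
    ∣ ∑< n e + e n ∣                          ≤⟨ ∣p+q∣≤∣p∣+∣q∣ (∑< n e) (e n) ⟩
    ∣ ∑< n e ∣ + ∣ e n ∣                      ≤⟨ +-mono-≤ (∑-bound {K} e≤ n) (e≤ n) ⟩
    K * (2ℚ * (1ℚ - ½ ^ n)) + K * ½ ^ n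
      ≡⟨ solve 2 (λ k h → k :* (con 2ℚ :* (con 1ℚ :- h)) :+ k :* h := k :* (con 2ℚ :* (con 1ℚ :- con ½ :* h))) refl K (½ ^ n) ⟩
    K * (2ℚ * (1ℚ - ½ ^ suc n)) ∎
    where open ≤-Reasoning

  p-nn≤p : ∀ p {q} → 0ℚ ≤ q → p - q ≤ p
  p-nn≤p p 0≤q = ≤-trans (+-monoʳ-≤ p (neg-antimono-≤ 0≤q)) (≤-reflexive (+-identityʳ p))

  0≤½^ : ∀ n → 0ℚ ≤ ½ ^ n
  0≤½^ n = <⇒≤ (0<½^ n)

  -- The decay is asymmetric on purpose: with rate 2⁻ⁿ for both sequences a factor n would appear.
  -- Shifting `e` halves K, and with h = 2⁻ⁿ the new column costs at most K L h². The expression 4(h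
  -- - h²) solves the resulting recurrence: half of it plus h² is its value at h/2.
  rem-bound′ : ∀ {K L e f} → 0ℚ ≤ K → (∀ a → ∣ e a ∣ ≤ K * ½ ^ a) → (∀ b → ∣ f b ∣ ≤ L * (½ ^ b * ½ ^ b)) →
    ∀ n → ∣ rem e f n ∣ ≤ K * L * (ι 4 * (½ ^ n - ½ ^ n * ½ ^ n))
  rem-bound′ {K} {L} 0≤K e≤ f≤ zero = ≤-reflexive (sym (*-zeroʳ (K * L)))
  rem-bound′ {K} {L} {e} {f} 0≤K e≤ f≤ (suc n) = begin
    ∣ rem e f (suc n) ∣                        ≡⟨ cong ∣_∣ (rem-suc e f n) ⟩
    ∣ rem e′ f n + ∑< n e′ * f n ∣             ≤⟨ ∣p+q∣≤∣p∣+∣q∣ (rem e′ f n) (∑< n e′ * f n) ⟩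
    ∣ rem e′ f n ∣ + ∣ ∑< n e′ * f n ∣         ≡⟨ cong (∣ rem e′ f n ∣ +_) (∣p*q∣≡∣p∣*∣q∣ (∑< n e′) (f n)) ⟩
    ∣ rem e′ f n ∣ + ∣ ∑< n e′ ∣ * ∣ f n ∣     ≤⟨ +-mono-≤ (rem-bound′ 0≤K/2 e′≤ f≤ n)
                                                  (≤-trans (*-monoˡ (0≤∣p∣ (∑< n e′)) (f≤ n)) (*-monoʳ 0≤bound ∑e′≤K)) ⟩
    K * ½ * L * (ι 4 * (h - h * h)) + K * (L * (h * h))
      ≡⟨ solve 3 (λ k l h → k :* con ½ :* l :* (con (ι 4) :* (h :- h :* h)) :+ k :* (l :* (h :* h))
                  := k :* l :* (con (ι 4) :* (con ½ :* h :- con ½ :* h :* (con ½ :* h)))) refl K L h ⟩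
    K * L * (ι 4 * (½ ^ suc n - ½ ^ suc n * ½ ^ suc n)) ∎
    where
    open ≤-Reasoning
    h = ½ ^ n
    e′ = e ∘ suc
    0≤K/2 : 0ℚ ≤ K * ½
    0≤K/2 = nn*nn 0≤K (nonNegative⁻¹ ½)
    e′≤ : ∀ a → ∣ e′ a ∣ ≤ K * ½ * ½ ^ a
    e′≤ a = ≤-trans (e≤ (suc a)) (≤-reflexive (sym (*-assoc K ½ (½ ^ a))))
    0≤bound : 0ℚ ≤ L * (h * h)
    0≤bound = ≤-trans (0≤∣p∣ (f n)) (f≤ n)
    ∑e′≤K : ∣ ∑< n e′ ∣ ≤ K
    ∑e′≤K = begin
      ∣ ∑< n e′ ∣                   ≤⟨ ∑-bound {K * ½} e′≤ n ⟩
      K * ½ * (2ℚ * (1ℚ - h))       ≡⟨ solve 2 (λ k h → k :* con ½ :* (con 2ℚ :* (con 1ℚ :- h)) := k :* (con 1ℚ :- h)) refl K h ⟩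
      K * (1ℚ - h)                  ≤⟨ *-monoˡ 0≤K (p-nn≤p 1ℚ (0≤½^ n)) ⟩
      K * 1ℚ                        ≡⟨ *-identityʳ K ⟩
      K ∎

  rem-bound : ∀ {K L e f} → 0ℚ ≤ K → 0ℚ ≤ L → (∀ a → ∣ e a ∣ ≤ K * ½ ^ a) → (∀ b → ∣ f b ∣ ≤ L * (½ ^ b * ½ ^ b)) →
    ∀ n → ∣ rem e f n ∣ ≤ K * L * (ι 4 * ½ ^ n)
  rem-bound 0≤K 0≤L e≤ f≤ n = ≤-trans (rem-bound′ 0≤K e≤ f≤ n)
    (*-monoˡ (nn*nn 0≤K 0≤L) (*-monoˡ (0≤ι 4) (p-nn≤p (½ ^ n) (nn*nn (0≤½^ n) (0≤½^ n)))))

  -- Powers of i and the addition theorem for truncated series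

  re-i^ im-i^ : ℕ → ℚ
  re-i^ zero    = 1ℚ
  re-i^ (suc m) = - im-i^ m
  im-i^ zero    = 0ℚ
  im-i^ (suc m) = re-i^ m

  ∣re-i^∣≤1 : ∀ m → ∣ re-i^ m ∣ ≤ 1ℚ
  ∣im-i^∣≤1 : ∀ m → ∣ im-i^ m ∣ ≤ 1ℚ
  ∣re-i^∣≤1 zero    = ≤-refl
  ∣re-i^∣≤1 (suc m) = ≤-trans (≤-reflexive (∣-p∣≡∣p∣ (im-i^ m))) (∣im-i^∣≤1 m)
  ∣im-i^∣≤1 zero    = <⇒≤ 0<1
  ∣im-i^∣≤1 (suc m) = ∣re-i^∣≤1 m

  re-i^-+ : ∀ a b → re-i^ (a ℕ.+ b) ≡ re-i^ a * re-i^ b - im-i^ a * im-i^ b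
  im-i^-+ : ∀ a b → im-i^ (a ℕ.+ b) ≡ im-i^ a * re-i^ b + re-i^ a * im-i^ b
  re-i^-+ zero    b = solve 2 (λ c s → c := con 1ℚ :* c :- con 0ℚ :* s) refl (re-i^ b) (im-i^ b)
  re-i^-+ (suc a) b = trans (cong -_ (im-i^-+ a b))
    (solve 4 (λ c s c′ s′ → :- (s :* c′ :+ c :* s′) := :- s :* c′ :- c :* s′) refl (re-i^ a) (im-i^ a) (re-i^ b) (im-i^ b))
  im-i^-+ zero    b = solve 2 (λ c s → s := con 0ℚ :* c :+ con 1ℚ :* s) refl (re-i^ b) (im-i^ b)
  im-i^-+ (suc a) b = trans (re-i^-+ a b)
    (solve 4 (λ c s c′ s′ → c :* c′ :- s :* s′ := c :* c′ :+ :- s :* s′) refl (re-i^ a) (im-i^ a) (re-i^ b) (im-i^ b))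

  -- The imaginary part of i^(k+a) · i^b depends on k + a + b only, so it factors out of the
  -- convolution. The offset k is there for the induction, in which every shift of `e` raises the
  -- exponent by one.
  conv-im : ∀ k e f m →
    conv (λ a → im-i^ (k ℕ.+ a) * e a) (λ b → re-i^ b * f b) m + conv (λ a → re-i^ (k ℕ.+ a) * e a) (λ b → im-i^ b * f b) m
    ≡ im-i^ (k ℕ.+ m) * conv e f m
  conv-im k e f zero = trans
    (solve 6 (λ s c s₀ c₀ a b → s :* a :* (c₀ :* b) :+ c :* a :* (s₀ :* b) := (s :* c₀ :+ c :* s₀) :* (a :* b)) refl
      (im-i^ (k ℕ.+ 0)) (re-i^ (k ℕ.+ 0)) (im-i^ 0) (re-i^ 0) (e 0) (f 0))
    (cong (_* (e 0 * f 0)) (trans (sym (im-i^-+ (k ℕ.+ 0) 0)) (cong im-i^ (ℕP.+-identityʳ (k ℕ.+ 0)))))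
  conv-im k e f (suc m) = begin
    (s * e 0 * (c′ * x) + conv (λ a → im-i^ (k ℕ.+ suc a) * e (suc a)) F m) + (c * e 0 * (s′ * x) + conv (λ a → re-i^ (k ℕ.+ suc a) * e (suc a)) G m)
      ≡⟨ cong₂ (λ p q → (s * e 0 * (c′ * x) + p) + (c * e 0 * (s′ * x) + q))
           (conv-cong (λ a → cong (λ t → im-i^ t * e (suc a)) (ℕP.+-suc k a)) (λ _ → refl) m)
           (conv-cong (λ a → cong (λ t → re-i^ t * e (suc a)) (ℕP.+-suc k a)) (λ _ → refl) m) ⟩
    (s * e 0 * (c′ * x) + p) + (c * e 0 * (s′ * x) + q)
      ≡⟨ solve 8 (λ s c s′ c′ a x p q → (s :* a :* (c′ :* x) :+ p) :+ (c :* a :* (s′ :* x) :+ q)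
                     := (s :* c′ :+ c :* s′) :* (a :* x) :+ (p :+ q)) refl s c s′ c′ (e 0) x p q ⟩
    (s * c′ + c * s′) * (e 0 * x) + (p + q)
      ≡⟨ cong₂ (λ u v → u * (e 0 * x) + v)
           (trans (sym (im-i^-+ (k ℕ.+ 0) (suc m))) (cong (λ t → im-i^ (t ℕ.+ suc m)) (ℕP.+-identityʳ k)))
           (trans (conv-im (suc k) (e ∘ suc) f m) (cong (λ t → im-i^ t * conv (e ∘ suc) f m) (sym (ℕP.+-suc k m)))) ⟩
    im-i^ (k ℕ.+ suc m) * (e 0 * x) + im-i^ (k ℕ.+ suc m) * conv (e ∘ suc) f m
      ≡⟨ sym (*-distribˡ-+ (im-i^ (k ℕ.+ suc m)) (e 0 * x) (conv (e ∘ suc) f m)) ⟩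
    im-i^ (k ℕ.+ suc m) * (e 0 * x + conv (e ∘ suc) f m) ∎
    where
    open ≡-Reasoning
    F G : ℕ → ℚ
    F b = re-i^ b * f b
    G b = im-i^ b * f b
    x = f (suc m)
    s = im-i^ (k ℕ.+ 0)
    c = re-i^ (k ℕ.+ 0)
    s′ = im-i^ (suc m)
    c′ = re-i^ (suc m)
    p = conv (λ a → im-i^ (suc k ℕ.+ a) * e (suc a)) F m
    q = conv (λ a → re-i^ (suc k ℕ.+ a) * e (suc a)) G m

  -- These are the cosine and sine series indexed by the exponent, with zeros in between, as parts
  -- of exp(ix). In this form the Cauchy product of exponential series applies.
  reTerm imTerm : ℚ → ℕ → ℚ
  reTerm x m = re-i^ m * expTerm x m
  imTerm x m = im-i^ m * expTerm x m

  -- By `conv-im` with offset 0 and `binomial`, the convolutions of the two mixed products add up to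
  -- `imTerm (x + y)`, so only the two remainders survive.
  im-addition-rem : ∀ x y n →
    ∑< n (imTerm x) * ∑< n (reTerm y) + ∑< n (reTerm x) * ∑< n (imTerm y) - ∑< n (imTerm (x + y))
    ≡ rem (imTerm x) (reTerm y) n + rem (reTerm x) (imTerm y) n
  im-addition-rem x y n = trans
    (cong (λ t → S x * C y + C x * S y - t) (trans
      (∑-cong (λ m → sym (trans (conv-im 0 (expTerm x) (expTerm y) m) (cong (im-i^ m *_) (binomial x y m)))) n)
      (∑-+ (conv (imTerm x) (reTerm y)) (conv (reTerm x) (imTerm y)) n)))
    (solve 4 (λ a b c d → a :+ b :- (c :+ d) := (a :- c) :+ (b :- d)) refl
      (S x * C y) (C x * S y) (∑< n (conv (imTerm x) (reTerm y))) (∑< n (conv (reTerm x) (imTerm y))))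
    where
    S C : ℚ → ℚ
    S x = ∑< n (imTerm x)
    C x = ∑< n (reTerm x)

  -- Since `[2B]^n/n!≤` bounds powers of 2B, writing B as half of 2B gains a second factor 2⁻ᵐ. This
  -- is the decay that `rem-bound` asks of its second sequence.
  expTerm-bound : ∀ b x m → ∣ x ∣ ≤ ι (suc b) → ∣ expTerm x m ∣ ≤ E b * (½ ^ m * ½ ^ m)
  expTerm-bound b x m x≤ = begin
    ∣ x ^ m * 1/! m ∣                   ≡⟨ trans (∣p*q∣≡∣p∣*∣q∣ (x ^ m) (1/! m)) (cong (∣ x ^ m ∣ *_) (0≤p⇒∣p∣≡p (0≤1/! m))) ⟩
    ∣ x ^ m ∣ * 1/! m                   ≤⟨ *-monoʳ (0≤1/! m) (∣^∣-mono x≤ m) ⟩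
    B ^ m * 1/! m                       ≡⟨ cong (λ t → t ^ m * 1/! m) (solve 1 (λ b → b := con ½ :* (b :+ b)) refl B) ⟩
    (½ * (B + B)) ^ m * 1/! m           ≡⟨ cong (_* 1/! m) (^-distrib-* ½ (B + B) m) ⟩
    ½ ^ m * (B + B) ^ m * 1/! m         ≡⟨ *-assoc (½ ^ m) ((B + B) ^ m) (1/! m) ⟩
    ½ ^ m * ((B + B) ^ m * 1/! m)       ≤⟨ *-monoˡ (0≤½^ m) ([2B]^n/n!≤ b m) ⟩
    ½ ^ m * (E b * ½ ^ m)               ≡⟨ solve 2 (λ h e → h :* (e :* h) := e :* (h :* h)) refl (½ ^ m) (E b) ⟩
    E b * (½ ^ m * ½ ^ m) ∎
    where
    open ≤-Reasoning
    B = ι (suc b)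

  ∣unit*p∣≤∣p∣ : ∀ {u} p → ∣ u ∣ ≤ 1ℚ → ∣ u * p ∣ ≤ ∣ p ∣
  ∣unit*p∣≤∣p∣ {u} p u≤1 = begin
    ∣ u * p ∣        ≡⟨ ∣p*q∣≡∣p∣*∣q∣ u p ⟩
    ∣ u ∣ * ∣ p ∣    ≤⟨ *-monoʳ (0≤∣p∣ p) u≤1 ⟩
    1ℚ * ∣ p ∣       ≡⟨ *-identityˡ ∣ p ∣ ⟩
    ∣ p ∣ ∎
    where open ≤-Reasoning

  ½^m*½^m≤½^m : ∀ m → ½ ^ m * ½ ^ m ≤ ½ ^ m
  ½^m*½^m≤½^m m = ≤-trans (*-monoˡ (0≤½^ m) (½^-anti {0} {m} ℕ.z≤n)) (≤-reflexive (*-identityʳ (½ ^ m)))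

  im-addition-bound : ∀ b x y n → ∣ x ∣ ≤ ι (suc b) → ∣ y ∣ ≤ ι (suc b) →
    ∣ ∑< n (imTerm (x + y)) - (∑< n (imTerm x) * ∑< n (reTerm y) + ∑< n (reTerm x) * ∑< n (imTerm y)) ∣
    ≤ E b * E b * ι 8 * ½ ^ n
  im-addition-bound b x y n x≤ y≤ = begin
    ∣ ∑< n (imTerm (x + y)) - sum ∣          ≡⟨ |-|-comm (∑< n (imTerm (x + y))) sum ⟩
    ∣ sum - ∑< n (imTerm (x + y)) ∣          ≡⟨ cong ∣_∣ (im-addition-rem x y n) ⟩
    ∣ R₁ + R₂ ∣                              ≤⟨ ∣p+q∣≤∣p∣+∣q∣ R₁ R₂ ⟩
    ∣ R₁ ∣ + ∣ R₂ ∣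
      -- The decay 4⁻ᵐ is kept for the second factor of each product and weakened to 2⁻ᵐ for the
      -- first. Each remainder costs 4 E² 2⁻ⁿ, hence the 8.
      ≤⟨ +-mono-≤ (rem-bound 0≤E 0≤E (coarse ∣im-i^∣≤1 x≤) (fine ∣re-i^∣≤1 y≤) n)
                  (rem-bound 0≤E 0≤E (coarse ∣re-i^∣≤1 x≤) (fine ∣im-i^∣≤1 y≤) n) ⟩
    E b * E b * (ι 4 * ½ ^ n) + E b * E b * (ι 4 * ½ ^ n)
      ≡⟨ solve 2 (λ e h → e :* e :* (con (ι 4) :* h) :+ e :* e :* (con (ι 4) :* h) := e :* e :* con (ι 8) :* h) refl (E b) (½ ^ n) ⟩
    E b * E b * ι 8 * ½ ^ n ∎
    where
    open ≤-Reasoning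
    sum = ∑< n (imTerm x) * ∑< n (reTerm y) + ∑< n (reTerm x) * ∑< n (imTerm y)
    R₁ = rem (imTerm x) (reTerm y) n
    R₂ = rem (reTerm x) (imTerm y) n
    0≤E = <⇒≤ (0<E b)
    fine : ∀ {u : ℕ → ℚ} {z} → (∀ m → ∣ u m ∣ ≤ 1ℚ) → ∣ z ∣ ≤ ι (suc b) → ∀ m → ∣ u m * expTerm z m ∣ ≤ E b * (½ ^ m * ½ ^ m)
    fine {u} {z} u≤1 z≤ m = ≤-trans (∣unit*p∣≤∣p∣ (expTerm z m) (u≤1 m)) (expTerm-bound b z m z≤)
    coarse : ∀ {u : ℕ → ℚ} {z} → (∀ m → ∣ u m ∣ ≤ 1ℚ) → ∣ z ∣ ≤ ι (suc b) → ∀ m → ∣ u m * expTerm z m ∣ ≤ E b * ½ ^ m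
    coarse u≤1 z≤ m = ≤-trans (fine u≤1 z≤ m) (*-monoˡ 0≤E (½^m*½^m≤½^m m))

  re-i^-2* : ∀ k → re-i^ (2 ℕ.* k) ≡ (- 1ℚ) ^ k
  im-i^-2* : ∀ k → im-i^ (2 ℕ.* k) ≡ 0ℚ
  re-i^-2* zero    = refl
  re-i^-2* (suc k) = trans (cong re-i^ (ℕP.*-suc 2 k)) (trans (cong -_ (re-i^-2* k))
    (solve 1 (λ p → :- p := con (- 1ℚ) :* p) refl ((- 1ℚ) ^ k)))
  im-i^-2* zero    = refl
  im-i^-2* (suc k) = trans (cong im-i^ (ℕP.*-suc 2 k)) (cong -_ (im-i^-2* k))

  -- Each step adds the exponents 2n and 2n + 1, and the odd power of i has real part zero.
  ∑-reTerm : ∀ x n → ∑< (2 ℕ.* n) (reTerm x) ≡ ∑< n (cosTerm x)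
  ∑-reTerm x zero    = refl
  ∑-reTerm x (suc n) = trans (cong (λ t → ∑< t (reTerm x)) (ℕP.*-suc 2 n)) (begin
    ∑< m (reTerm x) + re-i^ m * expTerm x m + - im-i^ m * expTerm x (suc m)
      ≡⟨ cong₂ (λ p q → ∑< m (reTerm x) + p * expTerm x m + - q * expTerm x (suc m)) (re-i^-2* n) (im-i^-2* n) ⟩
    ∑< m (reTerm x) + cosTerm x n + - 0ℚ * expTerm x (suc m)
      ≡⟨ solve 2 (λ p q → p :+ con (- 0ℚ) :* q := p) refl (∑< m (reTerm x) + cosTerm x n) (expTerm x (suc m)) ⟩
    ∑< m (reTerm x) + cosTerm x n
      ≡⟨ cong (_+ cosTerm x n) (∑-reTerm x n) ⟩
    ∑< n (cosTerm x) + cosTerm x n ∎)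
    where
    open ≡-Reasoning
    m = 2 ℕ.* n

  ∑-imTerm : ∀ x n → ∑< (2 ℕ.* n) (imTerm x) ≡ ∑< n (sinTerm x)
  ∑-imTerm x zero    = refl
  ∑-imTerm x (suc n) = trans (cong (λ t → ∑< t (imTerm x)) (ℕP.*-suc 2 n)) (begin
    ∑< m (imTerm x) + im-i^ m * expTerm x m + re-i^ m * expTerm x (suc m)
      ≡⟨ cong₂ (λ p q → ∑< m (imTerm x) + q * expTerm x m + p * expTerm x (suc m)) (re-i^-2* n) (im-i^-2* n) ⟩
    ∑< m (imTerm x) + 0ℚ * expTerm x m + (- 1ℚ) ^ n * expTerm x (suc m)
      ≡⟨ solve 3 (λ p q r → p :+ con 0ℚ :* q :+ r := p :+ r) refl (∑< m (imTerm x)) (expTerm x m) _ ⟩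
    ∑< m (imTerm x) + (- 1ℚ) ^ n * expTerm x (suc m)
      ≡⟨ cong₂ (λ p t → p + (- 1ℚ) ^ n * expTerm x t) (∑-imTerm x n) (ℕP.+-comm 1 m) ⟩
    ∑< n (sinTerm x) + sinTerm x n ∎)
    where
    open ≡-Reasoning
    m = 2 ℕ.* n

  sin-addition-bound : ∀ b x y n → ∣ x ∣ ≤ ι (suc b) → ∣ y ∣ ≤ ι (suc b) →
    ∣ ∑< n (sinTerm (x + y)) - (∑< n (sinTerm x) * ∑< n (cosTerm y) + ∑< n (cosTerm x) * ∑< n (sinTerm y)) ∣
    ≤ E b * E b * ι 8 * ½ ^ n
  sin-addition-bound b x y n x≤ y≤ = ≤-trans (≤-reflexive (cong ∣_∣ (cong₂ _-_ (sym (∑-imTerm (x + y) n))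
      (cong₂ _+_ (cong₂ _*_ (sym (∑-imTerm x n)) (sym (∑-reTerm y n))) (cong₂ _*_ (sym (∑-reTerm x n)) (sym (∑-imTerm y n)))))))
    -- Here n terms of sine and cosine are 2n terms of the exponential series; the error 2⁻²ⁿ is
    -- weakened to 2⁻ⁿ.
    (≤-trans (im-addition-bound b x y (2 ℕ.* n) x≤ y≤)
      (*-monoˡ (nn*nn (nn*nn (<⇒≤ (0<E b)) (<⇒≤ (0<E b))) (0≤ι 8)) (½^-anti (ℕP.m≤m+n n _))))

  -- Parity of the sine and cosine terms

  neg-^-2* : ∀ y k → (- y) ^ (2 ℕ.* k) ≡ y ^ (2 ℕ.* k)
  neg-^-2* y zero    = refl
  neg-^-2* y (suc k) = begin
    (- y) ^ (2 ℕ.* suc k)          ≡⟨ cong ((- y) ^_) (ℕP.*-suc 2 k) ⟩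
    - y * (- y * (- y) ^ (2 ℕ.* k)) ≡⟨ cong (λ t → - y * (- y * t)) (neg-^-2* y k) ⟩
    - y * (- y * y ^ (2 ℕ.* k))    ≡⟨ solve 2 (λ y p → :- y :* (:- y :* p) := y :* (y :* p)) refl y (y ^ (2 ℕ.* k)) ⟩
    y * (y * y ^ (2 ℕ.* k))        ≡⟨ cong (y ^_) (sym (ℕP.*-suc 2 k)) ⟩
    y ^ (2 ℕ.* suc k) ∎
    where open ≡-Reasoning

  cosTerm-even : ∀ y k → cosTerm (- y) k ≡ cosTerm y k
  cosTerm-even y k = cong (λ t → (- 1ℚ) ^ k * (t * 1/! (2 ℕ.* k))) (neg-^-2* y k)

  sinTerm-odd : ∀ y k → sinTerm (- y) k ≡ - sinTerm y k
  sinTerm-odd y k = trans (cong (λ t → (- 1ℚ) ^ k * (t * f)) (begin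
      (- y) ^ (2 ℕ.* k ℕ.+ 1)  ≡⟨ cong ((- y) ^_) (ℕP.+-comm (2 ℕ.* k) 1) ⟩
      - y * (- y) ^ (2 ℕ.* k)  ≡⟨ cong (- y *_) (neg-^-2* y k) ⟩
      - y * y ^ (2 ℕ.* k)      ≡⟨ sym (neg-distribˡ-* y (y ^ (2 ℕ.* k))) ⟩
      - (y * y ^ (2 ℕ.* k))    ≡⟨ cong (λ t → - (y ^ t)) (ℕP.+-comm 1 (2 ℕ.* k)) ⟩
      - (y ^ (2 ℕ.* k ℕ.+ 1)) ∎))
    (solve 3 (λ a p f → a :* (:- p :* f) := :- (a :* (p :* f))) refl ((- 1ℚ) ^ k) (y ^ (2 ℕ.* k ℕ.+ 1)) f)
    where
    open ≡-Reasoning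
    f = 1/! (2 ℕ.* k ℕ.+ 1)

  -- Fractions j/n between 0 and 1

  /-*ι : ∀ j n .{{_ : NonZero n}} → (ℤ.+ j / n) * ι n ≡ ι j
  /-*ι j n@(suc m) = toℚᵘ-injective (ℚᵘP.≃-trans (toℚᵘ-homo-* (ℤ.+ j / n) (ι n))
    (ℚᵘP.≃-trans (ℚᵘP.*-cong (toℚᵘ-fromℚᵘ (mkℚᵘ (ℤ.+ j) m)) (ι≃ n))
      (ℚᵘP.≃-trans (*≡* (ℤP.*-assoc (ℤ.+ j) (ℤ.+ n) (ℤ.+ 1))) (ℚᵘP.≃-sym (ι≃ j)))))

  ι-mono-< : ∀ {j n} → j ℕ.< n → ι j < ι n
  ι-mono-< {j} {n} j<n = <-≤-trans (subst₂ _<_ (+-identityˡ (ι j)) (sym (ι-suc j)) (+-monoˡ-< (ι j) 0<1)) (ι-mono j<n)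

  0<j/n : ∀ j n .{{_ : NonZero n}} → 0 ℕ.< j → 0ℚ < ℤ.+ j / n
  0<j/n j n 0<j = *-cancelʳ-<-nonNeg (ι n) {{nonNegative (0≤ι n)}}
    (subst₂ _<_ (sym (*-zeroˡ (ι n))) (sym (/-*ι j n)) (ι-mono-< 0<j))

  j/n<1 : ∀ j n .{{_ : NonZero n}} → j ℕ.< n → ℤ.+ j / n < 1ℚ
  j/n<1 j n j<n = *-cancelʳ-<-nonNeg (ι n) {{nonNegative (0≤ι n)}}
    (subst₂ _<_ (sym (/-*ι j n)) (sym (*-identityˡ (ι n))) (ι-mono-< j<n))

-- Real equality and the addition theorem for sine

module RealLemmas where
  open import Data.Rational hiding (NonZero)
  open import Data.Rational.Properties
  open import Data.Rational.Solver
  open +-*-Solver using (solve; _:=_; _:+_; _:*_; :-_; _:-_; con)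
  open Aux
  open CauchyAux
  open SeriesAux
  open RootAux
  open RationalEstimates

  eventually-≡⇒≈ : ∀ {x y} N → (∀ n → N ℕ.≤ n → seq x n ≡ seq y n) → x ≈ᴿ y
  close (eventually-≡⇒≈ {x} {y} N h) ε 0<ε = N , λ n N≤n →
    ≤-trans (≤-reflexive (trans (cong (λ t → ∣ t - seq y n ∣) (h n N≤n)) (∣p-p∣≡0 (seq y n)))) (<⇒≤ 0<ε)

  -- Ring identities in ℝ hold on every rational approximation, so this reduces them to the solver
  -- for ℚ.
  pointwise : ∀ {x y} → (∀ n → seq x n ≡ seq y n) → x ≈ᴿ y
  pointwise h = eventually-≡⇒≈ 0 (λ n _ → h n)

  ≈-refl : ∀ {x} → x ≈ᴿ x
  ≈-refl = pointwise (λ _ → refl)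

  ≈-trans : ∀ {x y z} → x ≈ᴿ y → y ≈ᴿ z → x ≈ᴿ z
  ≈-trans {x} {y} {z} p q = ≈-K 2ℚ (positive⁻¹ 2ℚ) λ ε 0<ε →
    let (M , hp) = close p ε 0<ε ; (N , hq) = close q ε 0<ε in
    M ℕ.⊔ N , λ n le → begin
      ∣ seq x n - seq z n ∣                            ≤⟨ |-|-trans (seq x n) (seq y n) (seq z n) ⟩
      ∣ seq x n - seq y n ∣ + ∣ seq y n - seq z n ∣    ≤⟨ +-mono-≤ (hp n (ℕP.m⊔n≤o⇒m≤o M N le)) (hq n (ℕP.m⊔n≤o⇒n≤o M N le)) ⟩
      ε + ε                                            ≡⟨ solve 1 (λ e → e :+ e := con 2ℚ :* e) refl ε ⟩
      2ℚ * ε ∎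
    where open ≤-Reasoning

  -ᴿ-cong : ∀ {x y} → x ≈ᴿ y → -ᴿ x ≈ᴿ -ᴿ y
  close (-ᴿ-cong {x} {y} p) ε 0<ε = proj₁ (close p ε 0<ε) , λ n le → ≤-trans (≤-reflexive (trans
    (cong ∣_∣ (solve 2 (λ a b → :- a :- :- b := :- (a :- b)) refl (seq x n) (seq y n))) (∣-p∣≡∣p∣ (seq x n - seq y n))))
    (proj₂ (close p ε 0<ε) n le)

  eventually-bounded₂ : ∀ x y → ∃[ b ] ∃[ N ] (∀ n → N ℕ.≤ n → ∣ seq x n ∣ ≤ ι (suc b) × ∣ seq y n ∣ ≤ ι (suc b))
  eventually-bounded₂ x y =
    let (A , M , hx) = eventually-bounded {seq x} (cauchy x)
        (B , N , hy) = eventually-bounded {seq y} (cauchy y) in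
    A ℕ.⊔ B , M ℕ.⊔ N , λ n le →
      ≤-trans (hx n (ℕP.m⊔n≤o⇒m≤o M N le)) (ι-mono (ℕ.s≤s (ℕP.m≤m⊔n A B))) ,
      ≤-trans (hy n (ℕP.m⊔n≤o⇒n≤o M N le)) (ι-mono (ℕ.s≤s (ℕP.m≤n⊔m A B)))

  -- The Lipschitz constant `E b * 2ℚ` of the partial sums does not depend on the number of terms,
  -- so it survives the diagonal summation.
  sin-cong : ∀ {x y} → x ≈ᴿ y → sin x ≈ᴿ sin y
  sin-cong {x} {y} p =
    let (b , N , h) = eventually-bounded₂ x y in
    ≈-K (E b * 2ℚ) (pos*pos (0<E b) (positive⁻¹ 2ℚ)) λ ε 0<ε →
    let (M , hp) = close p ε 0<ε in
    M ℕ.⊔ N , λ n le →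
    let (x≤ , y≤) = h n (ℕP.m⊔n≤o⇒n≤o M N le) in begin
      ∣ ∑< n (sinTerm (seq x n)) - ∑< n (sinTerm (seq y n)) ∣  ≤⟨ ∑-lipschitz′ sin-entire b (seq x n) (seq y n) x≤ y≤ n ⟩
      ∣ seq x n - seq y n ∣ * (E b * 2ℚ)                      ≤⟨ *-monoʳ (<⇒≤ (pos*pos (0<E b) (positive⁻¹ 2ℚ))) (hp n (ℕP.m⊔n≤o⇒m≤o M N le)) ⟩
      ε * (E b * 2ℚ)                                          ≡⟨ *-comm ε (E b * 2ℚ) ⟩
      E b * 2ℚ * ε ∎
    where open ≤-Reasoning

  -- At index n every sine and cosine is the n-term sum at the n-th approximation. The rational
  -- bound therefore applies index by index, and no limits have to be interchanged.
  sin-+ : ∀ x y → sin (x +ᴿ y) ≈ᴿ sin x *ᴿ cos y +ᴿ cos x *ᴿ sin y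
  close (sin-+ x y) ε 0<ε =
    let (b , N , h) = eventually-bounded₂ x y
        (M , small) = SumAux.½^-small′ (E b * E b * ι 8) (pos*pos (pos*pos (0<E b) (0<E b)) (0<ι 8)) ε 0<ε in
    M ℕ.⊔ N , λ n le →
    let (x≤ , y≤) = h n (ℕP.m⊔n≤o⇒n≤o M N le) in
    ≤-trans (sin-addition-bound b (seq x n) (seq y n) n x≤ y≤) (small n (ℕP.m⊔n≤o⇒m≤o M N le))

  cos-neg : ∀ x → cos (-ᴿ x) ≈ᴿ cos x
  cos-neg x = pointwise λ n → ∑-cong (cosTerm-even (seq x n)) n

  sin-neg : ∀ x → sin (-ᴿ x) ≈ᴿ -ᴿ sin x
  sin-neg x = pointwise λ n → trans (∑-cong (sinTerm-odd (seq x n)) n) (∑-neg (sinTerm (seq x n)) n)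

  sin-sum-diff : ∀ x y → sin (x +ᴿ y) +ᴿ sin (x +ᴿ -ᴿ y) ≈ᴿ fromℚ 2ℚ *ᴿ cos y *ᴿ sin x
  sin-sum-diff x y = ≈-trans
    (+ᴿ-cong (sin-+ x y) (≈-trans (sin-+ x (-ᴿ y)) (+ᴿ-cong (*ᴿ-cong (≈-refl {sin x}) (cos-neg y)) (*ᴿ-cong (≈-refl {cos x}) (sin-neg y)))))
    (pointwise λ n → solve 4 (λ sx cx sy cy → (sx :* cy :+ cx :* sy) :+ (sx :* cy :+ cx :* :- sy) := con 2ℚ :* cy :* sx) refl
      (seq (sin x) n) (seq (cos x) n) (seq (sin y) n) (seq (cos y) n))

  -- Chebyshev polynomials and multiples of an angle

  -- U c (k + 1) is the value at c of the k-th Chebyshev polynomial of the second kind.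
  U : ℝ → ℕ → ℝ
  U c zero          = 0ᴿ
  U c (suc zero)    = 1ᴿ
  U c (suc (suc k)) = fromℚ 2ℚ *ᴿ c *ᴿ U c (suc k) +ᴿ -ᴿ U c k

  sin-0 : sin 0ᴿ ≈ᴿ 0ᴿ
  sin-0 = pointwise λ n → trans (∑-cong sinTerm-0 n) (∑-0 n)
    where
    sinTerm-0 : ∀ k → sinTerm 0ℚ k ≡ 0ℚ
    sinTerm-0 k = trans (cong (λ t → (- 1ℚ) ^ k * (0ℚ ^ t * f)) (ℕP.+-comm (2 ℕ.* k) 1))
      (solve 3 (λ a p f → a :* (con 0ℚ :* p :* f) := con 0ℚ) refl ((- 1ℚ) ^ k) (0ℚ ^ (2 ℕ.* k)) f)
      where f = 1/! (2 ℕ.* k ℕ.+ 1)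
    ∑-0 : ∀ n → ∑< n (λ _ → 0ℚ) ≡ 0ℚ
    ∑-0 zero    = refl
    ∑-0 (suc n) = cong (_+ 0ℚ) (∑-0 n)

  sin-multiple : ∀ x k → sin (fromℚ (ι k) *ᴿ x) ≈ᴿ sin x *ᴿ U (cos x) k
  sin-multiple x zero = ≈-trans (sin-cong {fromℚ 0ℚ *ᴿ x} {0ᴿ} (pointwise λ n → *-zeroˡ (seq x n)))
    (≈-trans sin-0 (pointwise λ n → sym (*-zeroʳ (seq (sin x) n))))
  sin-multiple x (suc zero) = ≈-trans (sin-cong {fromℚ 1ℚ *ᴿ x} {x} (pointwise λ n → *-identityˡ (seq x n)))
    (pointwise λ n → sym (*-identityʳ (seq (sin x) n)))
  sin-multiple x (suc (suc k)) = ≈-trans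
    -- Adding and subtracting sin(kx) brings in `sin-sum-diff` at the angles (k + 1)x and x, which
    -- yields the recurrence of `U`.
    (pointwise λ n → solve 2 (λ a b → a := (a :+ b) :- b) refl (seq (sin (fromℚ (ι (suc (suc k))) *ᴿ x)) n) (seq (sin (fromℚ (ι k) *ᴿ x)) n))
    (≈-trans
      (+ᴿ-cong
        (≈-trans
          (+ᴿ-cong
            (sin-cong {fromℚ (ι (suc (suc k))) *ᴿ x} {fromℚ (ι (suc k)) *ᴿ x +ᴿ x} (pointwise λ n → trans (cong (_* seq x n) (ι-suc (suc k)))
              (solve 2 (λ i t → (con 1ℚ :+ i) :* t := i :* t :+ t) refl (ι (suc k)) (seq x n))))
            (sin-cong {fromℚ (ι k) *ᴿ x} {fromℚ (ι (suc k)) *ᴿ x +ᴿ -ᴿ x} (pointwise λ n → sym (trans (cong (λ i → i * seq x n - seq x n) (ι-suc k))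
              (solve 2 (λ i t → (con 1ℚ :+ i) :* t :- t := i :* t) refl (ι k) (seq x n))))))
          (≈-trans (sin-sum-diff (fromℚ (ι (suc k)) *ᴿ x) x) (*ᴿ-cong (≈-refl {fromℚ 2ℚ *ᴿ cos x}) (sin-multiple x (suc k)))))
        (-ᴿ-cong (sin-multiple x k)))
      (pointwise λ n → solve 4 (λ s c u v → con 2ℚ :* c :* (s :* u) :+ :- (s :* v) := s :* (con 2ℚ :* c :* u :+ :- v)) refl
        (seq (sin x) n) (seq (cos x) n) (seq (U (cos x) (suc k)) n) (seq (U (cos x) k) n)))

  -- Cancellation, reciprocals and order in ℝ

  -- Only the single rational `seq y N` is compared, which is decidable. If its absolute value is at
  -- least 2δ, then y stays at least δ away from 0 from N on, and this forces `x ≈ᴿ 0ᴿ`, a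
  -- contradiction. Otherwise y stays within 3δ of 0.
  x*y≈0∧x≉0⇒y≈0 : ∀ {x y} → x *ᴿ y ≈ᴿ 0ᴿ → ¬ (x ≈ᴿ 0ᴿ) → y ≈ᴿ 0ᴿ
  close (x*y≈0∧x≉0⇒y≈0 {x} {y} xy≈0 x≉0) ε 0<ε = N , λ n le → begin
      ∣ seq y n - 0ℚ ∣                 ≡⟨ cong ∣_∣ (+-identityʳ (seq y n)) ⟩
      ∣ seq y n ∣                      ≡⟨ cong ∣_∣ (solve 2 (λ a b → a := (a :- b) :+ b) refl (seq y n) (seq y N)) ⟩
      ∣ (seq y n - seq y N) + seq y N ∣ ≤⟨ ∣p+q∣≤∣p∣+∣q∣ (seq y n - seq y N) (seq y N) ⟩
      ∣ seq y n - seq y N ∣ + ∣ seq y N ∣ ≤⟨ +-mono-≤ (hN n N le ℕP.≤-refl) yN≤ ⟩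
      δ + 2ℚ * δ                       ≤⟨ p≤p+q ⟩
      (δ + 2ℚ * δ) + δ                 ≡⟨ solve 1 (λ e → (con ¼ :* e :+ con 2ℚ :* (con ¼ :* e)) :+ con ¼ :* e := e) refl ε ⟩
      ε ∎
    where
    open ≤-Reasoning
    ¼ : ℚ
    ¼ = ½ * ½
    -- A quarter of ε leaves room for the bound 3δ.
    δ : ℚ
    δ = ¼ * ε
    0<δ : 0ℚ < δ
    0<δ = pos*pos (positive⁻¹ ¼) 0<ε
    N = proj₁ (cauchy y δ 0<δ)
    hN = proj₂ (cauchy y δ 0<δ)
    p≤p+q : ∀ {p} → p ≤ p + δ
    p≤p+q {p} = ≤-trans (≤-reflexive (sym (+-identityʳ p))) (+-monoʳ-≤ p (<⇒≤ 0<δ))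
    x≈0 : 2ℚ * δ ≤ ∣ seq y N ∣ → x ≈ᴿ 0ᴿ
    close (x≈0 2δ≤) η 0<η = M ℕ.⊔ N , λ n le →
      -- The product is made smaller than δη, so that dividing by the lower bound δ on y leaves η.
      *-cancelˡ-≤-pos δ {{positive 0<δ}} (begin
        δ * ∣ seq x n - 0ℚ ∣            ≡⟨ cong (λ t → δ * ∣ t ∣) (+-identityʳ (seq x n)) ⟩
        δ * ∣ seq x n ∣                 ≤⟨ *-monoʳ (0≤∣p∣ (seq x n)) (δ≤ n (ℕP.m⊔n≤o⇒n≤o M N le)) ⟩
        ∣ seq y n ∣ * ∣ seq x n ∣       ≡⟨ trans (*-comm ∣ seq y n ∣ ∣ seq x n ∣) (sym (∣p*q∣≡∣p∣*∣q∣ (seq x n) (seq y n))) ⟩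
        ∣ seq x n * seq y n ∣           ≡⟨ cong ∣_∣ (sym (+-identityʳ (seq x n * seq y n))) ⟩
        ∣ seq x n * seq y n - 0ℚ ∣      ≤⟨ proj₂ h n (ℕP.m⊔n≤o⇒m≤o M N le) ⟩
        δ * η ∎)
      where
      h = close xy≈0 (δ * η) (pos*pos 0<δ 0<η)
      M = proj₁ h
      δ≤ : ∀ n → N ℕ.≤ n → δ ≤ ∣ seq y n ∣
      δ≤ n le = begin
        δ                                                ≡⟨ solve 1 (λ d → d := con 2ℚ :* d :- d) refl δ ⟩
        2ℚ * δ - δ                                       ≤⟨ +-mono-≤ 2δ≤ (neg-antimono-≤ (hN N n ℕP.≤-refl le)) ⟩
        ∣ seq y N ∣ - ∣ seq y N - seq y n ∣              ≡⟨ cong (λ t → ∣ t ∣ - ∣ seq y N - seq y n ∣) (solve 2 (λ a b → a := (a :- b) :+ b) refl (seq y N) (seq y n)) ⟩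
        ∣ (seq y N - seq y n) + seq y n ∣ - ∣ seq y N - seq y n ∣
          ≤⟨ +-monoˡ-≤ (- ∣ seq y N - seq y n ∣) (∣p+q∣≤∣p∣+∣q∣ (seq y N - seq y n) (seq y n)) ⟩
        ∣ seq y N - seq y n ∣ + ∣ seq y n ∣ - ∣ seq y N - seq y n ∣ ≡⟨ solve 2 (λ a b → a :+ b :- a := b) refl ∣ seq y N - seq y n ∣ ∣ seq y n ∣ ⟩
        ∣ seq y n ∣ ∎
    yN≤ : ∣ seq y N ∣ ≤ 2ℚ * δ
    yN≤ with ≤-total ∣ seq y N ∣ (2ℚ * δ)
    ... | inj₁ le = le
    ... | inj₂ ge = contradiction (x≈0 ge) x≉0

  -- Before the index N an approximation of x may be zero, where `recip` takes its default value 0.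
  -- Equality of the approximations is therefore claimed only from N on.
  recipᴿ-inverse : ∀ x (0<x : 0ᴿ <ᴿ x) → recipᴿ x 0<x *ᴿ x ≈ᴿ 1ᴿ
  recipᴿ-inverse x (ε , 0<ε , N , h) = eventually-≡⇒≈ N λ n N≤n →
    RecipAux.recip-* (seq x n) (RecipAux.<⇒≢0 (<-≤-trans 0<ε (≤-trans (≤-reflexive (sym (+-identityˡ ε))) (h n N≤n))))

  scale-0< : ∀ {p x} → 0ℚ < p → 0ᴿ <ᴿ x → 0ᴿ <ᴿ fromℚ p *ᴿ x
  scale-0< {p} {x} 0<p (ε , 0<ε , N , h) = p * ε , pos*pos 0<p 0<ε , N , λ n N≤n → begin
    0ℚ + p * ε      ≡⟨ solve 2 (λ p e → con 0ℚ :+ p :* e := p :* (con 0ℚ :+ e)) refl p ε ⟩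
    p * (0ℚ + ε)    ≤⟨ *-monoˡ (<⇒≤ 0<p) (h n N≤n) ⟩
    p * seq x n ∎
    where open ≤-Reasoning

  scale-< : ∀ {p q x} → p < q → 0ᴿ <ᴿ x → fromℚ p *ᴿ x <ᴿ fromℚ q *ᴿ x
  scale-< {p} {q} {x} p<q 0<x =
    let (ε , 0<ε , N , h) = scale-0< {q - p} {x} (subst (_< q - p) (+-inverseʳ p) (+-monoˡ-< (- p) p<q)) 0<x in
    ε , 0<ε , N , λ n N≤n → begin
      p * seq x n + ε                          ≡⟨ cong (p * seq x n +_) (sym (+-identityˡ ε)) ⟩
      p * seq x n + (0ℚ + ε)                   ≤⟨ +-monoʳ-≤ (p * seq x n) (h n N≤n) ⟩
      p * seq x n + (q - p) * seq x n          ≡⟨ solve 3 (λ p q x → p :* x :+ (q :- p) :* x := q :* x) refl p q (seq x n) ⟩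
      q * seq x n ∎
    where open ≤-Reasoning

  <ᴿ-respʳ-≡ : ∀ {x y z} → (∀ n → seq y n ≡ seq z n) → x <ᴿ y → x <ᴿ z
  <ᴿ-respʳ-≡ {x} y≡z (ε , 0<ε , N , h) = ε , 0<ε , N , λ n N≤n → ≤-trans (h n N≤n) (≤-reflexive (y≡z n))

  -- Zeros of the Chebyshev polynomials

  module _ {π} (isPi : IsPi π) where
    open IsPi isPi

    sin-jπ : ∀ j → sin (fromℚ (ι j) *ᴿ π) ≈ᴿ 0ᴿ
    sin-jπ j = ≈-trans (sin-multiple π j)
      (≈-trans (*ᴿ-cong sinπ≈0 (≈-refl {U (cos π) j})) (pointwise λ n → *-zeroˡ (seq (U (cos π) j) n)))

    U-zero : ∀ j n .{{_ : NonZero n}} → 0 ℕ.< j → j ℕ.< n → U (cos (fromℚ (ℤ.+ j / n) *ᴿ π)) n ≈ᴿ 0ᴿ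
    U-zero j n 0<j j<n = x*y≈0∧x≉0⇒y≈0 {sin θ}
      (≈-trans (≈-sym (sin-multiple θ n)) (≈-trans (sin-cong {fromℚ (ι n) *ᴿ θ} {fromℚ (ι j) *ᴿ π} nθ≈jπ) (sin-jπ j)))
      -- Minimality of π excludes `sin θ ≈ᴿ 0ᴿ`, since 0 < j/n < 1 places θ strictly between 0 and
      -- π. The upper comparison goes through 1 · π.
      (least θ (scale-0< {x = π} (0<j/n j n 0<j) 0<π)
        (<ᴿ-respʳ-≡ {θ} {fromℚ 1ℚ *ᴿ π} {π} (λ k → *-identityˡ (seq π k)) (scale-< {x = π} (j/n<1 j n j<n) 0<π)))
      where
      θ = fromℚ (ℤ.+ j / n) *ᴿ π
      nθ≈jπ : fromℚ (ι n) *ᴿ θ ≈ᴿ fromℚ (ι j) *ᴿ π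
      nθ≈jπ = pointwise λ k → trans (sym (*-assoc (ι n) (ℤ.+ j / n) (seq π k)))
        (cong (_* seq π k) (trans (*-comm (ι n) (ℤ.+ j / n)) (/-*ι j n)))

-- Complex arithmetic

module ComplexLemmas where
  open import Data.Rational using (ℚ; 0ℚ; 1ℚ; _+_; _*_; -_)
  open import Data.Rational.Properties
  open import Data.Rational.Solver
  open +-*-Solver using (Polynomial; solve; _:=_; _:+_; _:*_; :-_; con)
  open SeriesAux using (2ℚ)
  open RootAux
  open RealLemmas

  pointwiseᶜ : ∀ {z w} → (∀ n → seq (re z) n ≡ seq (re w) n) → (∀ n → seq (im z) n ≡ seq (im w) n) → z ≈ᶜ w
  pointwiseᶜ p q = pointwise p , pointwise q

  ≈ᶜ-refl : ∀ {z} → z ≈ᶜ z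
  ≈ᶜ-refl = ≈-refl , ≈-refl

  ≈ᶜ-sym : ∀ {z w} → z ≈ᶜ w → w ≈ᶜ z
  ≈ᶜ-sym (p , q) = ≈-sym p , ≈-sym q

  ≈ᶜ-trans : ∀ {z w v} → z ≈ᶜ w → w ≈ᶜ v → z ≈ᶜ v
  ≈ᶜ-trans (p , q) (p′ , q′) = ≈-trans p p′ , ≈-trans q q′

  +ᶜ-cong : ∀ {z z′ w w′} → z ≈ᶜ z′ → w ≈ᶜ w′ → z +ᶜ w ≈ᶜ z′ +ᶜ w′
  +ᶜ-cong (p , q) (p′ , q′) = +ᴿ-cong p p′ , +ᴿ-cong q q′

  *ᶜ-cong : ∀ {z z′ w w′} → z ≈ᶜ z′ → w ≈ᶜ w′ → z *ᶜ w ≈ᶜ z′ *ᶜ w′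
  *ᶜ-cong (p , q) (p′ , q′) =
    +ᴿ-cong (*ᴿ-cong p p′) (-ᴿ-cong (*ᴿ-cong q q′)) , +ᴿ-cong (*ᴿ-cong p q′) (*ᴿ-cong q p′)

  -- Complex arithmetic on solver expressions, so that a ring identity in ℂ is checked on the
  -- rational approximations of real and imaginary parts.
  infixl 6 _⊕_
  infixl 7 _⊗_
  _⊕_ _⊗_ : ∀ {n} → Polynomial n × Polynomial n → Polynomial n × Polynomial n → Polynomial n × Polynomial n
  (a , b) ⊕ (c , d) = a :+ c , b :+ d
  (a , b) ⊗ (c , d) = a :* c :+ :- (b :* d) , a :* d :+ b :* c

  real : ∀ {n} → Polynomial n → Polynomial n × Polynomial n
  real a = a , con 0ℚ

  𝕚 : ∀ {n} → Polynomial n × Polynomial n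
  𝕚 = con 0ℚ , con 1ℚ

  1ᶜ : ℂ
  1ᶜ = fromℝ 1ᴿ

  *ᶜ-assoc : ∀ u v w → (u *ᶜ v) *ᶜ w ≈ᶜ u *ᶜ (v *ᶜ w)
  *ᶜ-assoc u v w = pointwiseᶜ
    (λ n → solve 6 (λ a b c d e f → proj₁ ((a , b) ⊗ (c , d) ⊗ (e , f)) := proj₁ ((a , b) ⊗ ((c , d) ⊗ (e , f)))) refl
      (seq (re u) n) (seq (im u) n) (seq (re v) n) (seq (im v) n) (seq (re w) n) (seq (im w) n))
    (λ n → solve 6 (λ a b c d e f → proj₂ ((a , b) ⊗ (c , d) ⊗ (e , f)) := proj₂ ((a , b) ⊗ ((c , d) ⊗ (e , f)))) refl
      (seq (re u) n) (seq (im u) n) (seq (re v) n) (seq (im v) n) (seq (re w) n) (seq (im w) n))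

  *ᶜ-identityʳ : ∀ z → z *ᶜ 1ᶜ ≈ᶜ z
  *ᶜ-identityʳ z = pointwiseᶜ
    (λ n → solve 2 (λ a b → proj₁ ((a , b) ⊗ real (con 1ℚ)) := a) refl (seq (re z) n) (seq (im z) n))
    (λ n → solve 2 (λ a b → proj₂ ((a , b) ⊗ real (con 1ℚ)) := b) refl (seq (re z) n) (seq (im z) n))

  *ᶜ-zeroʳ : ∀ z → z *ᶜ 0ᶜ ≈ᶜ 0ᶜ
  *ᶜ-zeroʳ z = pointwiseᶜ
    (λ n → solve 2 (λ a b → proj₁ ((a , b) ⊗ real (con 0ℚ)) := con 0ℚ) refl (seq (re z) n) (seq (im z) n))
    (λ n → solve 2 (λ a b → proj₂ ((a , b) ⊗ real (con 0ℚ)) := con 0ℚ) refl (seq (re z) n) (seq (im z) n))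

  *ᶜ-zeroˡ : ∀ z → 0ᶜ *ᶜ z ≈ᶜ 0ᶜ
  *ᶜ-zeroˡ z = pointwiseᶜ
    (λ n → solve 2 (λ a b → proj₁ (real (con 0ℚ) ⊗ (a , b)) := con 0ℚ) refl (seq (re z) n) (seq (im z) n))
    (λ n → solve 2 (λ a b → proj₂ (real (con 0ℚ) ⊗ (a , b)) := con 0ℚ) refl (seq (re z) n) (seq (im z) n))

  -- With t the reciprocal of |w|², the product is t times the conjugate of w times w. Its real part
  -- is t|w|², and its imaginary part cancels identically.
  recipᶜ-inverse : ∀ w (w≠0 : w ≠0) → recipᶜ w w≠0 *ᶜ w ≈ᶜ 1ᶜ
  recipᶜ-inverse w w≠0 =
    ≈-trans (pointwise λ n → solve 3 (λ a b t → a :* t :* a :+ :- (:- (b :* t) :* b) := t :* (a :* a :+ b :* b)) refl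
              (seq (re w) n) (seq (im w) n) (seq (recipᴿ ∣ w ∣² w≠0) n))
            (recipᴿ-inverse ∣ w ∣² w≠0) ,
    (pointwise λ n → solve 3 (λ a b t → a :* t :* b :+ :- (b :* t) :* a := con 0ℚ) refl
              (seq (re w) n) (seq (im w) n) (seq (recipᴿ ∣ w ∣² w≠0) n))

  ÷≈⇒≈* : ∀ {z w v} (w≠0 : w ≠0) → z ÷ w [ w≠0 ] ≈ᶜ v → z ≈ᶜ v *ᶜ w
  ÷≈⇒≈* {z} {w} {v} w≠0 z÷w≈v = ≈ᶜ-trans (≈ᶜ-sym (≈ᶜ-trans (*ᶜ-cong (≈ᶜ-refl {z}) (recipᶜ-inverse w w≠0)) (*ᶜ-identityʳ z)))
    (≈ᶜ-trans (≈ᶜ-sym (*ᶜ-assoc z (recipᶜ w w≠0) w)) (*ᶜ-cong z÷w≈v (≈ᶜ-refl {w})))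

  -- Evaluation of polynomials as a ring homomorphism

  eval-+ᴾ : ∀ p q z → eval (p +ᴾ q) z ≈ᶜ eval p z +ᶜ eval q z
  eval-+ᴾ [] q z = pointwiseᶜ
    (λ n → sym (+-identityˡ (seq (re (eval q z)) n))) (λ n → sym (+-identityˡ (seq (im (eval q z)) n)))
  eval-+ᴾ (a ∷ p) [] z = pointwiseᶜ
    (λ n → sym (+-identityʳ (seq (re (eval (a ∷ p) z)) n))) (λ n → sym (+-identityʳ (seq (im (eval (a ∷ p) z)) n)))
  eval-+ᴾ (a ∷ p) (b ∷ q) z = ≈ᶜ-trans
    (+ᶜ-cong (≈ᶜ-refl {fromℝ (fromℚ (a + b))}) (*ᶜ-cong (≈ᶜ-refl {z}) (eval-+ᴾ p q z)))
    (pointwiseᶜ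
      (λ n → solve 8 (λ a b x y u v s t → proj₁ (real (a :+ b) ⊕ (x , y) ⊗ ((u , v) ⊕ (s , t)))
                        := proj₁ ((real a ⊕ (x , y) ⊗ (u , v)) ⊕ (real b ⊕ (x , y) ⊗ (s , t)))) refl
        a b (seq (re z) n) (seq (im z) n) (seq (re (eval p z)) n) (seq (im (eval p z)) n) (seq (re (eval q z)) n) (seq (im (eval q z)) n))
      (λ n → solve 8 (λ a b x y u v s t → proj₂ (real (a :+ b) ⊕ (x , y) ⊗ ((u , v) ⊕ (s , t)))
                        := proj₂ ((real a ⊕ (x , y) ⊗ (u , v)) ⊕ (real b ⊕ (x , y) ⊗ (s , t)))) refl
        a b (seq (re z) n) (seq (im z) n) (seq (re (eval p z)) n) (seq (im (eval p z)) n) (seq (re (eval q z)) n) (seq (im (eval q z)) n)))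

  eval-scale : ∀ a q z → eval (map (a *_) q) z ≈ᶜ fromℝ (fromℚ a) *ᶜ eval q z
  eval-scale a [] z = ≈ᶜ-sym (*ᶜ-zeroʳ (fromℝ (fromℚ a)))
  eval-scale a (b ∷ q) z = ≈ᶜ-trans
    (+ᶜ-cong (≈ᶜ-refl {fromℝ (fromℚ (a * b))}) (*ᶜ-cong (≈ᶜ-refl {z}) (eval-scale a q z)))
    (pointwiseᶜ
      (λ n → solve 6 (λ a b x y u v → proj₁ (real (a :* b) ⊕ (x , y) ⊗ (real a ⊗ (u , v)))
                        := proj₁ (real a ⊗ (real b ⊕ (x , y) ⊗ (u , v)))) refl
        a b (seq (re z) n) (seq (im z) n) (seq (re (eval q z)) n) (seq (im (eval q z)) n))
      (λ n → solve 6 (λ a b x y u v → proj₂ (real (a :* b) ⊕ (x , y) ⊗ (real a ⊗ (u , v)))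
                        := proj₂ (real a ⊗ (real b ⊕ (x , y) ⊗ (u , v)))) refl
        a b (seq (re z) n) (seq (im z) n) (seq (re (eval q z)) n) (seq (im (eval q z)) n)))

  eval-*ᴾ : ∀ p q z → eval (p *ᴾ q) z ≈ᶜ eval p z *ᶜ eval q z
  eval-*ᴾ [] q z = ≈ᶜ-sym (*ᶜ-zeroˡ (eval q z))
  eval-*ᴾ (a ∷ p) q z = ≈ᶜ-trans (eval-+ᴾ (map (a *_) q) (0ℚ ∷ (p *ᴾ q)) z)
    (≈ᶜ-trans
      (+ᶜ-cong (eval-scale a q z) (+ᶜ-cong (≈ᶜ-refl {0ᶜ}) (*ᶜ-cong (≈ᶜ-refl {z}) (eval-*ᴾ p q z))))
      (pointwiseᶜ
        (λ n → solve 7 (λ a x y u v s t → proj₁ (real a ⊗ (s , t) ⊕ (real (con 0ℚ) ⊕ (x , y) ⊗ ((u , v) ⊗ (s , t))))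
                          := proj₁ ((real a ⊕ (x , y) ⊗ (u , v)) ⊗ (s , t))) refl
          a (seq (re z) n) (seq (im z) n) (seq (re (eval p z)) n) (seq (im (eval p z)) n) (seq (re (eval q z)) n) (seq (im (eval q z)) n))
        (λ n → solve 7 (λ a x y u v s t → proj₂ (real a ⊗ (s , t) ⊕ (real (con 0ℚ) ⊕ (x , y) ⊗ ((u , v) ⊗ (s , t))))
                          := proj₂ ((real a ⊕ (x , y) ⊗ (u , v)) ⊗ (s , t))) refl
          a (seq (re z) n) (seq (im z) n) (seq (re (eval p z)) n) (seq (im (eval p z)) n) (seq (re (eval q z)) n) (seq (im (eval q z)) n))))

  eval-ℱ-rec : ∀ d g z k →
    eval (ℱ d g (suc (suc k))) z ≈ᶜ eval d z *ᶜ eval (ℱ d g (suc k)) z +ᶜ eval g z *ᶜ eval (ℱ d g k) z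
  eval-ℱ-rec d g z k = ≈ᶜ-trans (eval-+ᴾ (d *ᴾ ℱ d g (suc k)) (g *ᴾ ℱ d g k) z)
    (+ᶜ-cong (eval-*ᴾ d (ℱ d g (suc k)) z) (eval-*ᴾ g (ℱ d g k) z))

  -- Closed form for the values of `ℱ`

  infixr 8 _^ᶜ_
  _^ᶜ_ : ℂ → ℕ → ℂ
  z ^ᶜ zero  = 1ᶜ
  z ^ᶜ suc k = z *ᶜ z ^ᶜ k

  -- Since g(r) = s² = -(is)², both terms of the recurrence carry the factor (is)ᵏ⁺², and the minus
  -- sign is the one in the recurrence of `U`. The indices of `ℱ` and `U` agree.
  eval-ℱ : ∀ d g r s c → eval d r ≈ᶜ (fromℝ (fromℚ 2ℚ) *ᶜ iᶜ *ᶜ fromℝ c) *ᶜ s → s *ᶜ s ≈ᶜ eval g r →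
    ∀ k → eval (ℱ d g (suc k)) r ≈ᶜ (iᶜ *ᶜ s) ^ᶜ k *ᶜ fromℝ (U c (suc k))
  eval-ℱ d g r s c d[r]≈ s²≈ zero = pointwiseᶜ
    (λ n → solve 2 (λ x y → proj₁ (real (con 1ℚ) ⊕ (x , y) ⊗ real (con 0ℚ)) := proj₁ (real (con 1ℚ) ⊗ real (con 1ℚ))) refl
      (seq (re r) n) (seq (im r) n))
    (λ n → solve 2 (λ x y → proj₂ (real (con 1ℚ) ⊕ (x , y) ⊗ real (con 0ℚ)) := proj₂ (real (con 1ℚ) ⊗ real (con 1ℚ))) refl
      (seq (re r) n) (seq (im r) n))
  -- The recurrence here reaches back to `ℱ d g 0`, which the induction does not cover; it evaluates
  -- to `0ᶜ` and its term drops out.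
  eval-ℱ d g r s c d[r]≈ s²≈ (suc zero) = ≈ᶜ-trans (eval-ℱ-rec d g r 0)
    (≈ᶜ-trans (+ᶜ-cong (*ᶜ-cong d[r]≈ (eval-ℱ d g r s c d[r]≈ s²≈ zero)) (*ᶜ-zeroʳ (eval g r)))
      (pointwiseᶜ
        (λ n → solve 3 (λ c x y → proj₁ (real (con 2ℚ) ⊗ 𝕚 ⊗ real c ⊗ (x , y) ⊗ (real (con 1ℚ) ⊗ real (con 1ℚ)) ⊕ real (con 0ℚ))
                          := proj₁ (𝕚 ⊗ (x , y) ⊗ real (con 1ℚ) ⊗ real (con 2ℚ :* c :* con 1ℚ :+ :- con 0ℚ))) refl
          (seq c n) (seq (re s) n) (seq (im s) n))
        (λ n → solve 3 (λ c x y → proj₂ (real (con 2ℚ) ⊗ 𝕚 ⊗ real c ⊗ (x , y) ⊗ (real (con 1ℚ) ⊗ real (con 1ℚ)) ⊕ real (con 0ℚ))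
                          := proj₂ (𝕚 ⊗ (x , y) ⊗ real (con 1ℚ) ⊗ real (con 2ℚ :* c :* con 1ℚ :+ :- con 0ℚ))) refl
          (seq c n) (seq (re s) n) (seq (im s) n))))
  eval-ℱ d g r s c d[r]≈ s²≈ (suc (suc k)) = ≈ᶜ-trans (eval-ℱ-rec d g r (suc k))
    -- Replacing g(r) by s² leaves an identity in c, s, (is)ᵏ and two values of `U`, which the
    -- solver settles in each component.
    (≈ᶜ-trans (+ᶜ-cong (*ᶜ-cong d[r]≈ (eval-ℱ d g r s c d[r]≈ s²≈ (suc k))) (*ᶜ-cong (≈ᶜ-sym s²≈) (eval-ℱ d g r s c d[r]≈ s²≈ k)))
      (pointwiseᶜ
        (λ n → solve 7 (λ c x y p q u v →
            proj₁ (real (con 2ℚ) ⊗ 𝕚 ⊗ real c ⊗ (x , y) ⊗ ((𝕚 ⊗ (x , y) ⊗ (p , q)) ⊗ real u) ⊕ (x , y) ⊗ (x , y) ⊗ ((p , q) ⊗ real v))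
            := proj₁ ((𝕚 ⊗ (x , y) ⊗ (𝕚 ⊗ (x , y) ⊗ (p , q))) ⊗ real (con 2ℚ :* c :* u :+ :- v))) refl
          (seq c n) (seq (re s) n) (seq (im s) n) (seq (re ((iᶜ *ᶜ s) ^ᶜ k)) n) (seq (im ((iᶜ *ᶜ s) ^ᶜ k)) n)
          (seq (U c (suc (suc k))) n) (seq (U c (suc k)) n))
        (λ n → solve 7 (λ c x y p q u v →
            proj₂ (real (con 2ℚ) ⊗ 𝕚 ⊗ real c ⊗ (x , y) ⊗ ((𝕚 ⊗ (x , y) ⊗ (p , q)) ⊗ real u) ⊕ (x , y) ⊗ (x , y) ⊗ ((p , q) ⊗ real v))
            := proj₂ ((𝕚 ⊗ (x , y) ⊗ (𝕚 ⊗ (x , y) ⊗ (p , q))) ⊗ real (con 2ℚ :* c :* u :+ :- v))) refl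
          (seq c n) (seq (re s) n) (seq (im s) n) (seq (re ((iᶜ *ᶜ s) ^ᶜ k)) n) (seq (im ((iᶜ *ᶜ s) ^ᶜ k)) n)
          (seq (U c (suc (suc k))) n) (seq (U c (suc k)) n))))

  fromℝ-cong : ∀ {x y} → x ≈ᴿ y → fromℝ x ≈ᶜ fromℝ y
  fromℝ-cong p = p , ≈-refl

-- The points with d(r)/s = γⱼ are roots

open import Data.Nat using (_≤_; _<_)
open import Data.Rational using (_/_)
open RealLemmas using (U; U-zero)
open ComplexLemmas

theorem4p3 : (d g : Poly) → Nonzero d → Nonzero g → degree g < degree d →
    (π : ℝ) → IsPi π →
    (n : ℕ) .{{_ : NonZero n}} → 2 ≤ n →
    (r s : ℂ) (g[r]≠0 : eval g r ≠0) (s²≈g[r] : s *ᶜ s ≈ᶜ eval g r) →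
    ∃[ j ] (1 ≤ j × j < n × eval d r ÷ s [ sqrt-≠0 s (eval g r) s²≈g[r] g[r]≠0 ] ≈ᶜ γ π n j) →
    eval (ℱ d g n) r ≈ᶜ 0ᶜ
theorem4p3 d g _ _ _ π isPi n@(suc k) _ r s g[r]≠0 s²≈g[r] (j , 1≤j , j<n , d/s≈γ) =
  -- Clearing the denominator gives d(r) = γⱼ s, and `γ π n j` unfolds to 2ic. As n = k + 1, the
  -- closed form at k ends in the factor `U c n`, which vanishes.
  ≈ᶜ-trans (eval-ℱ d g r s c (÷≈⇒≈* (sqrt-≠0 s (eval g r) s²≈g[r] g[r]≠0) d/s≈γ) s²≈g[r] k)
    (≈ᶜ-trans (*ᶜ-cong (≈ᶜ-refl {(iᶜ *ᶜ s) ^ᶜ k}) (fromℝ-cong (U-zero isPi j n 1≤j j<n)))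
      (*ᶜ-zeroʳ ((iᶜ *ᶜ s) ^ᶜ k)))
  where
  c = cos (fromℚ (ℤ.+ j / n) *ᴿ π)
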